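{- For every $t\in\mathbb{N}$ there exists $c=c(t)\in\mathbb{N}$ with the following property. Let $G$ be a $K_{t,t}$-free graph, let $\omega=\omega(G)$, and let $Z\subseteq V(G)$ be constricted. Then for every vertex $v\in V(G)\setminus Z$ there exist at most $\omega^c$ paths starting in $Z$ and ending at $v$ that are pairwise vertex-disjoint except at $v$.
   Context: Graphs are finite and simple; $K_{t,t}$-free means no induced subgraph isomorphic to $K_{t,t}$; paths are induced paths; $\omega(G)$ is the clique number. A set $Z\subseteq V(G)$ is constricted if it is stable and for every induced subgraph $T$ of $G$ that is a tree, $|Z\cap V(T)|\leq 2$. -}

module Defs where

open import Data.Nat using (ℕ; zero; suc; _≤_; _^_)
open import Data.Fin using (Fin; toℕ; fromℕ) renaming (zero to fzero)
open import Data.Fin.Subset using (Subset; _∈_; _∉_; _∩_; ∣_∣)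
open import Data.Bool using (Bool; true; false)
open import Data.Product using (Σ; _×_; ∃; _,_)
open import Data.Sum using (_⊎_)
open import Relation.Binary.PropositionalEquality using (_≡_; _≢_)
open import Relation.Nullary using (¬_)
open import Function.Definitions using (Injective)

record Graph : Set where
  field
    n   : ℕ
    adj : Fin n → Fin n → Bool
    sym : ∀ x y → adj x y ≡ adj y x
    irr : ∀ x → adj x x ≡ false

open Graph public

V : Graph → Set
V G = Fin (n G)

Adj : (G : Graph) → V G → V G → Set
Adj G x y = adj G x y ≡ true

NonAdj : (G : Graph) → V G → V G → Set
NonAdj G x y = adj G x y ≡ false

Consec : ∀ {k} → Fin k → Fin k → Set
Consec i j = (suc (toℕ i) ≡ toℕ j) ⊎ (suc (toℕ j) ≡ toℕ i)

IsClique : (G : Graph) (s : ℕ) → (Fin s → V G) → Set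
IsClique G s f = Injective _≡_ _≡_ f × (∀ i j → i ≢ j → Adj G (f i) (f j))

IsCliqueNumber : Graph → ℕ → Set
IsCliqueNumber G w =
  (Σ (Fin w → V G) λ f → IsClique G w f) ×
  (∀ s (f : Fin s → V G) → IsClique G s f → s ≤ w)

HasInducedKtt : Graph → ℕ → Set
HasInducedKtt G t =
  Σ (Fin t → V G) λ a → Σ (Fin t → V G) λ b →
    Injective _≡_ _≡_ a × Injective _≡_ _≡_ b ×
    (∀ i j → a i ≢ b j) ×
    (∀ i j → NonAdj G (a i) (a j)) ×
    (∀ i j → NonAdj G (b i) (b j)) ×
    (∀ i j → Adj G (a i) (b j))

KttFree : Graph → ℕ → Set
KttFree G t = ¬ HasInducedKtt G t

VSet : Graph → Set
VSet G = Subset (n G)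

Stable : (G : Graph) → VSet G → Set
Stable G Z = ∀ x y → x ∈ Z → y ∈ Z → NonAdj G x y

ConnectedIn : (G : Graph) → VSet G → Set
ConnectedIn G S = ∀ x y → x ∈ S → y ∈ S →
  Σ ℕ λ k → Σ (Fin (suc k) → V G) λ p →
    (p fzero ≡ x) × (p (fromℕ k) ≡ y) × (∀ i → p i ∈ S) ×
    (∀ i j → suc (toℕ i) ≡ toℕ j → Adj G (p i) (p j))

HasCycleIn : (G : Graph) → VSet G → Set
HasCycleIn G S =
  Σ ℕ λ k → Σ (Fin (suc k) → V G) λ p →
    (2 ≤ k) × Injective _≡_ _≡_ p × (∀ i → p i ∈ S) ×
    (∀ i j → suc (toℕ i) ≡ toℕ j → Adj G (p i) (p j)) ×
    Adj G (p (fromℕ k)) (p fzero)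

IsInducedTree : (G : Graph) → VSet G → Set
IsInducedTree G S = ConnectedIn G S × ¬ HasCycleIn G S

Constricted : (G : Graph) → VSet G → Set
Constricted G Z = Stable G Z × (∀ S → IsInducedTree G S → ∣ Z ∩ S ∣ ≤ 2)

IsInducedPath : (G : Graph) (k : ℕ) → (Fin (suc k) → V G) → Set
IsInducedPath G k p =
  Injective _≡_ _≡_ p ×
  (∀ i j → Adj G (p i) (p j) → Consec i j) ×
  (∀ i j → Consec i j → Adj G (p i) (p j))

PathFamily : (G : Graph) → VSet G → V G → (m : ℕ) →
  (len : Fin m → ℕ) → ((i : Fin m) → Fin (suc (len i)) → V G) → Set
PathFamily G Z v m len P =
  (∀ i → IsInducedPath G (len i) (P i)) ×
  (∀ i → P i fzero ∈ Z) ×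
  (∀ i → P i (fromℕ (len i)) ≡ v) ×
  (∀ i j → i ≢ j → ∀ a b → P i a ≡ P j b → P i a ≡ v)

{-# OPTIONS --safe #-}
module Submission where

-- Call an induced path with both ends in Z a Z-path.  A path from Z that first touches a Z-path P
-- in a vertex u meets P in exactly two consecutive neighbours of u: in every other case P and the
-- path to u contain a subdivided claw with its three leaves in Z.
--
-- Suppose first that v lies on a Z-path, and fix the neighbours α and β of v on it.  Among the
-- Z-paths through α, v, β choose one, P, with a third path from Z attached as close to v as
-- possible on the β side, and then as close as possible on the α side.  Minimality forces every
-- path from v to Z to cross P at one of the two chosen attachments, or at v itself.  The paths
-- crossing at the same attachment give a complete bipartite graph between their crossing vertices
-- and the first vertices at which they reach the attachment, so by Ramsey's theorem there are few
-- of them.  A path crossing at v has its first vertex x adjacent to α or β; applying the same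
-- statement to the neighbours α and x of v shows that almost all such first vertices are pairwise
-- adjacent, so there are few of these as well.
--
-- If v lies on no Z-path, let y be the first vertex on one of the given paths that lies on a
-- Z-path.  Crossing vertices lie on Z-paths, so each of the given paths contains a neighbour of y
-- or of one of the two attachments at y.  These three vertices lie on Z-paths, so the first case applies.

open import Defs
open import Data.Nat using (ℕ; zero; suc; _+_; _*_; _≤_; _<_; _^_; z≤n; s≤s)
import Data.Nat.Properties as ℕₚ
open import Data.Nat.Induction using (<-rec)
open import Data.Nat.Tactic.RingSolver using (solve-∀)
open import Data.Fin using (Fin; toℕ; fromℕ; fromℕ<; inject₁)
import Data.Fin as Fin
import Data.Fin.Properties as Finₚ
open import Data.Fin.Subset using (_∉_)
import Data.Fin.Subset as Sub
import Data.Fin.Subset.Properties as Subₚ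
open import Data.Bool using (true; false)
open import Data.Maybe using (Maybe; just; nothing)
open import Data.List using (List; []; _∷_; _++_; length; tabulate; lookup)
import Data.List.Properties as Listₚ
open import Data.List.Relation.Unary.Any using (here; there)
open import Data.List.Relation.Unary.All as All using (All; []; _∷_)
open import Data.List.Relation.Unary.AllPairs using (AllPairs; []; _∷_)
import Data.List.Relation.Unary.AllPairs.Properties as AllPairsₚ
open import Data.List.Relation.Binary.Sublist.Propositional using (_⊆_; []; _∷_; _∷ʳ_; ⊆-refl; ⊆-trans; minimum)
open import Data.List.Relation.Binary.Sublist.Propositional.Properties using (All-resp-⊆)
open import Data.List.Membership.Propositional using (_∈_) renaming (_∉_ to _∉ˡ_)
open import Data.List.Membership.Propositional.Properties using (∈-++⁺ˡ; ∈-++⁺ʳ; ∈-++⁻; ∈-lookup)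
import Data.List.Membership.DecPropositional as DecMembership
open import Data.Product using (Σ; _×_; _,_; proj₁; proj₂)
open import Data.Sum using (_⊎_; inj₁; inj₂)
open import Data.Unit using (⊤; tt)
open import Data.Empty using (⊥; ⊥-elim)
open import Relation.Nullary using (¬_; Dec; yes; no)
open import Relation.Binary.PropositionalEquality using (_≡_; _≢_; refl; trans; cong; subst) renaming (sym to ≡-sym)
open import Function using (_∘_; id)
open import Function.Definitions using (Injective)

-- A given path may run into the parts beyond an attachment before it can be compared with P. The
-- attachment itself provides the remedy: beyond it, the old end of P and the attached leg are
-- interchangeable, so a Z-path can be chosen that avoids the part just met. The left and the right
-- leg may touch each other, however, so only one of them can replace its end of P at a time. This
-- is why the two minimisations are ordered: a closer right attachment is a contradiction by itself,
-- whereas a closer left one must come on a Z-path that still has a right attachment at the minimal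
-- distance.
--
-- The complete bipartite graph at an attachment depends on taking the earliest possible crossing on
-- each given path: if one path could switch to the end of another, it would cross earlier.
--
-- Paths are read from v towards Z and cut at their first vertex in Z. Attachments and Z-paths are
-- not searched for but obtained by minimisation under double negation; this costs nothing, since
-- all bounds are inequalities between natural numbers and may be proved by refuting the opposite.

module Basics (G : Graph) where

  infix 4 _~_ _#_ _≟_

  _≟_ : (x y : V G) → Dec (x ≡ y)
  _≟_ = Finₚ._≟_

  _~_ : V G → V G → Set
  _~_ = Adj G

  ~-sym : ∀ {x y} → x ~ y → y ~ x
  ~-sym {x} {y} p = trans (Graph.sym G y x) p

  ~⇒≢ : ∀ {x y} → x ~ y → x ≢ y
  ~⇒≢ {x} p refl with trans (≡-sym (irr G x)) p
  ... | ()

  _#_ : V G → V G → Set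
  x # y = x ≢ y × NonAdj G x y

  #-sym : ∀ {x y} → x # y → y # x
  #-sym {x} {y} (n , a) = n ∘ ≡-sym , trans (Graph.sym G y x) a

  #⇒≁ : ∀ {x y} → x # y → ¬ (x ~ y)
  #⇒≁ (_ , a) p with trans (≡-sym a) p
  ... | ()

  _#?_ : ∀ x y → Dec (x # y)
  x #? y with x ≟ y | adj G x y in eq
  ... | yes e | _     = no (λ h → proj₁ h e)
  ... | no  n | false = yes (n , refl)
  ... | no  n | true  = no (λ h → #⇒≁ (proj₁ h , trans eq (proj₂ h)) eq)

  ¬#⇒~ : ∀ {x y} → ¬ (x # y) → x ≢ y → x ~ y
  ¬#⇒~ {x} {y} h n with adj G x y
  ... | true  = refl
  ... | false = ⊥-elim (h (n , refl))

  _⋕_ : V G → List (V G) → Set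
  x ⋕ l = ∀ {y} → y ∈ l → x # y

  Anti : List (V G) → List (V G) → Set
  Anti l m = ∀ {x y} → x ∈ l → y ∈ m → x # y

  Anti-sym : ∀ {l m} → Anti l m → Anti m l
  Anti-sym a p q = #-sym (a q p)

  -- Induced trees grown leaf by leaf.

  data Grow : List (V G) → Set where
    one : ∀ x → Grow (x ∷ [])
    add : ∀ {x y ts} → Grow ts → y ∈ ts → x ~ y → (∀ {z} → z ∈ ts → z ≢ y → x # z) → Grow (x ∷ ts)

  set : List (V G) → VSet G
  set []       = Sub.⊥
  set (x ∷ l) = Sub.⁅ x ⁆ Sub.∪ set l

  ∈-set⁺ : ∀ {x l} → x ∈ l → x Sub.∈ set l
  ∈-set⁺ {l = y ∷ l} (here refl) = Subₚ.x∈p∪q⁺ (inj₁ (Subₚ.x∈⁅x⁆ y))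
  ∈-set⁺ {l = y ∷ l} (there p)   = Subₚ.x∈p∪q⁺ (inj₂ (∈-set⁺ p))

  ∈-set⁻ : ∀ {x} l → x Sub.∈ set l → x ∈ l
  ∈-set⁻ []      p = ⊥-elim (Subₚ.∉⊥ p)
  ∈-set⁻ (y ∷ l) p with Subₚ.x∈p∪q⁻ Sub.⁅ y ⁆ (set l) p
  ... | inj₁ q = here (Subₚ.x∈⁅y⁆⇒x≡y y q)
  ... | inj₂ q = there (∈-set⁻ l q)

  data Walk (ts : List (V G)) : V G → V G → Set where
    stop : ∀ {x} → x ∈ ts → Walk ts x x
    move : ∀ {x y z} → x ∈ ts → x ~ y → Walk ts y z → Walk ts x z

  Walk-weaken : ∀ {ts t x y} → Walk ts x y → Walk (t ∷ ts) x y
  Walk-weaken (stop p)     = stop (there p)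
  Walk-weaken (move p a w) = move (there p) a (Walk-weaken w)

  Walk-snoc : ∀ {ts x y z} → Walk ts x y → y ~ z → z ∈ ts → Walk ts x z
  Walk-snoc (stop p)     a q = move p a (stop q)
  Walk-snoc (move p b w) a q = move p b (Walk-snoc w a q)

  grow-walk : ∀ {ts} → Grow ts → ∀ {x y} → x ∈ ts → y ∈ ts → Walk ts x y
  grow-walk (one _) (here refl) (here refl) = stop (here refl)
  grow-walk (add g _ _ _) (here refl) (here refl) = stop (here refl)
  grow-walk (add g q a _) (here refl) (there p) = move (here refl) a (Walk-weaken (grow-walk g q p))
  grow-walk (add g q a _) (there p) (here refl) = Walk-snoc (Walk-weaken (grow-walk g p q)) (~-sym a) (here refl)
  grow-walk (add g _ _ _) (there p) (there p') = Walk-weaken (grow-walk g p p')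

  walk⇒fun : ∀ {ts x y} → Walk ts x y → Σ ℕ λ k → Σ (Fin (suc k) → V G) λ p →
    (p Fin.zero ≡ x) × (p (fromℕ k) ≡ y) × (∀ i → p i Sub.∈ set ts) ×
    (∀ i j → suc (toℕ i) ≡ toℕ j → Adj G (p i) (p j))
  walk⇒fun {x = x} (stop q) = 0 , (λ _ → x) , refl , refl , (λ _ → ∈-set⁺ q) , λ { Fin.zero Fin.zero () }
  walk⇒fun {ts} {x} (move q a w) with walk⇒fun w
  ... | k , p , e₁ , e₂ , ins , adjs = suc k , p' , refl , e₂ , ins' , adjs'
    where
    p' : Fin (suc (suc k)) → V G
    p' Fin.zero    = x
    p' (Fin.suc i) = p i
    ins' : ∀ i → p' i Sub.∈ set ts
    ins' Fin.zero    = ∈-set⁺ q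
    ins' (Fin.suc i) = ins i
    adjs' : ∀ i j → suc (toℕ i) ≡ toℕ j → Adj G (p' i) (p' j)
    adjs' Fin.zero    Fin.zero ()
    adjs' Fin.zero    (Fin.suc Fin.zero) _ = subst (x ~_) (≡-sym e₁) a
    adjs' Fin.zero    (Fin.suc (Fin.suc _)) ()
    adjs' (Fin.suc i) Fin.zero ()
    adjs' (Fin.suc i) (Fin.suc j) e = adjs i j (ℕₚ.suc-injective e)

  cycle-neighbours : ∀ k (p : Fin (suc k) → V G) → 2 ≤ k →
    (∀ i j → suc (toℕ i) ≡ toℕ j → Adj G (p i) (p j)) → Adj G (p (fromℕ k)) (p Fin.zero) →
    ∀ i → Σ (Fin (suc k)) λ j → Σ (Fin (suc k)) λ j' → j ≢ j' × p i ~ p j × p i ~ p j'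
  cycle-neighbours (suc zero) p (s≤s ()) adjs close _
  cycle-neighbours (suc (suc k)) p _ adjs close Fin.zero =
    Fin.suc Fin.zero , fromℕ (suc (suc k)) , (λ ()) , adjs _ _ refl , ~-sym close
  cycle-neighbours (suc (suc k)) p (s≤s (s≤s _)) adjs close (Fin.suc i) with ℕₚ.m≤n⇒m<n∨m≡n (Finₚ.toℕ≤pred[n] (Fin.suc i))
  ... | inj₂ e = inject₁ i , Fin.zero , ne , ~-sym (adjs _ _ (cong suc (Finₚ.toℕ-inject₁ i))) ,
                 subst (λ t → p t ~ p Fin.zero) (≡-sym i≡) close
    where
    i≡ : Fin.suc i ≡ fromℕ (suc (suc k))
    i≡ = Finₚ.toℕ-injective (trans e (≡-sym (Finₚ.toℕ-fromℕ (suc (suc k)))))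
    ne : inject₁ i ≢ Fin.zero
    ne q with trans (≡-sym (ℕₚ.suc-injective e)) (trans (≡-sym (Finₚ.toℕ-inject₁ i)) (cong toℕ q))
    ... | ()
  ... | inj₁ l = inject₁ i , fromℕ< (s≤s l) , ne , ~-sym (adjs _ _ (cong suc (Finₚ.toℕ-inject₁ i))) ,
                 adjs _ _ (≡-sym (Finₚ.toℕ-fromℕ< (s≤s l)))
    where
    ne : inject₁ i ≢ fromℕ< (s≤s l)
    ne q = ℕₚ.<⇒≢ (ℕₚ.m≤n⇒m≤1+n (ℕₚ.n<1+n (toℕ i)))
             (trans (≡-sym (Finₚ.toℕ-inject₁ i)) (trans (cong toℕ q) (Finₚ.toℕ-fromℕ< (s≤s l))))

  -- A cycle through the newest leaf would give that leaf two distinct neighbours in the tree, but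
  -- it has only one. A cycle that misses the leaf lies in the smaller tree.
  grow-acyclic : ∀ {ts} → Grow ts → ¬ HasCycleIn G (set ts)
  grow-acyclic (one x) (suc k , p , _ , inj , ins , adjs , _)
    with inj (trans (eq Fin.zero) (≡-sym (eq (Fin.suc Fin.zero))))
    where
    eq : ∀ i → p i ≡ x
    eq i with ∈-set⁻ (x ∷ []) (ins i)
    ... | here e = e
  ... | ()
  grow-acyclic (add {x} {y} {ts} g q a far) (k , p , 2≤k , inj , ins , adjs , close)
    with Finₚ.any? (λ i → p i ≟ x)
  ... | no none = grow-acyclic g (k , p , 2≤k , inj , (λ i → ∈-set⁺ (in-ts i)) , adjs , close)
    where
    in-ts : ∀ i → p i ∈ ts
    in-ts i with ∈-set⁻ (x ∷ ts) (ins i)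
    ... | here e  = ⊥-elim (none (i , e))
    ... | there r = r
  ... | yes (i , refl) with cycle-neighbours k p 2≤k adjs close i
  ...   | j , j' , ne , b , b' = ne (inj (trans (only j b) (≡-sym (only j' b'))))
    where
    only : ∀ j → p i ~ p j → p j ≡ y
    only j b with ∈-set⁻ (x ∷ ts) (ins j)
    ... | here e  = ⊥-elim (~⇒≢ b (≡-sym e))
    ... | there r with p j ≟ y
    ...   | yes e = e
    ...   | no n  = ⊥-elim (#⇒≁ (far r n) b)

  grow-tree : ∀ {ts} → Grow ts → IsInducedTree G (set ts)
  grow-tree {ts} g = (λ x y p q → walk⇒fun (grow-walk g (∈-set⁻ ts p) (∈-set⁻ ts q))) , grow-acyclic g

  three-members : ∀ (S : VSet G) {x y z} → x Sub.∈ S → y Sub.∈ S → z Sub.∈ S →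
                  x ≢ y → x ≢ z → y ≢ z → 3 ≤ Sub.∣ S ∣
  three-members S {x} {y} {z} p q r xy xz yz =
    ℕₚ.≤-trans (s≤s (ℕₚ.≤-trans (s≤s (ℕₚ.≤-trans (s≤s z≤n) (Subₚ.x∈p⇒∣p-x∣<∣p∣ r''))) (Subₚ.x∈p⇒∣p-x∣<∣p∣ q'))) (Subₚ.x∈p⇒∣p-x∣<∣p∣ p)
    where
    q' : y Sub.∈ S Sub.- x
    q' = Subₚ.x∈p∧x≢y⇒x∈p-y q (xy ∘ ≡-sym)
    r'' : z Sub.∈ (S Sub.- x) Sub.- y
    r'' = Subₚ.x∈p∧x≢y⇒x∈p-y (Subₚ.x∈p∧x≢y⇒x∈p-y r (xz ∘ ≡-sym)) (yz ∘ ≡-sym)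

  -- Legs ending in Z and the forbidden spider.

  module Legs (Z : V G → Set) where

    -- Leg x l says that x ∷ l is an induced path whose last vertex is in Z.
    data Leg : V G → List (V G) → Set where
      end  : ∀ {x} → Z x → Leg x []
      step : ∀ {x y l} → x ~ y → x ⋕ l → Leg y l → Leg x (y ∷ l)

    leg-∉ : ∀ {x l} → Leg x l → ∀ {y} → y ∈ l → x ≢ y
    leg-∉ (step a _ _) (here refl) = ~⇒≢ a
    leg-∉ (step _ f _) (there p)   = proj₁ (f p)

    leg-end : ∀ {x l} → Leg x l → Σ (V G) λ z → Z z × (z ∈ x ∷ l)
    leg-end (end z)      = _ , z , here refl
    leg-end (step _ _ l) with leg-end l
    ... | z , zz , p = z , zz , there p

    leg-end⁺ : ∀ {x y l} → Leg x (y ∷ l) → Σ (V G) λ z → Z z × (z ∈ y ∷ l)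
    leg-end⁺ (step _ _ l) = leg-end l

    grow-leg : ∀ {ts c l} → Grow ts → c ∈ ts → Leg c l →
               (∀ {t x} → t ∈ ts → t ≢ c → x ∈ l → x # t) →
               Σ (List (V G)) λ ts' → Grow ts' × (∀ {t} → t ∈ ts → t ∈ ts') × (∀ {t} → t ∈ l → t ∈ ts') ×
                 (∀ {t} → t ∈ ts' → t ∈ ts ⊎ t ∈ l)
    grow-leg {ts} g p (end _) far = ts , g , (λ q → q) , (λ ()) , inj₁
    grow-leg {ts} {c} {y ∷ l} g p (step a f leg) far
      with grow-leg (add g p (~-sym a) (λ q n → far q n (here refl))) (here refl) leg far'
      where
      far' : ∀ {t x} → t ∈ y ∷ ts → t ≢ y → x ∈ l → x # t
      far' (here refl) n _ = ⊥-elim (n refl)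
      far' {t} (there q) n r with t ≟ c
      ... | yes refl = #-sym (f r)
      ... | no  m    = far q m (there r)
    ... | ts' , g' , i₁ , i₂ , o = ts' , g' , (λ q → i₁ (there q)) , (λ { (here refl) → i₁ (here refl) ; (there q) → i₂ q }) , out
      where
      out : ∀ {t} → t ∈ ts' → t ∈ ts ⊎ t ∈ y ∷ l
      out q with o q
      ... | inj₁ (here e)  = inj₂ (here e)
      ... | inj₁ (there r) = inj₁ r
      ... | inj₂ r         = inj₂ (there r)

    -- Only the last two legs are required to be nonempty. If `l₁` is empty, then `c` itself is in
    -- `Z`, and what is excluded is an induced path with both ends and an inner vertex in `Z`.
    Spiderless : Set
    Spiderless = ∀ {c l₁ y l₂ z l₃} → Leg c l₁ → Leg c (y ∷ l₂) → Leg c (z ∷ l₃) →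
                 Anti l₁ (y ∷ l₂) → Anti l₁ (z ∷ l₃) → Anti (y ∷ l₂) (z ∷ l₃) → ⊥

  spiderless : (Z : VSet G) → Constricted G Z → Legs.Spiderless (Sub._∈ Z)
  spiderless Z (_ , con) {c} {l₁} {y} {l₂} {z} {l₃} L₁ L₂ L₃ a₁₂ a₁₃ a₂₃
    with grow-leg (one c) (here refl) L₁ (λ { (here refl) n → ⊥-elim (n refl) ; (there ()) })
    where open Legs (Sub._∈ Z)
  ... | ts₁ , g₁ , i₁ , j₁ , o₁
    with grow-leg g₁ (i₁ (here refl)) L₂ far₂
    where
    open Legs (Sub._∈ Z)
    far₂ : ∀ {t x} → t ∈ ts₁ → t ≢ c → x ∈ y ∷ l₂ → x # t
    far₂ p n q with o₁ p
    ... | inj₁ (here e) = ⊥-elim (n e)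
    ... | inj₂ r = #-sym (a₁₂ r q)
  ... | ts₂ , g₂ , i₂ , j₂ , o₂
    with grow-leg g₂ (i₂ (i₁ (here refl))) L₃ far₃
    where
    open Legs (Sub._∈ Z)
    far₃ : ∀ {t x} → t ∈ ts₂ → t ≢ c → x ∈ z ∷ l₃ → x # t
    far₃ p n q with o₂ p
    ... | inj₂ r = #-sym (a₂₃ r q)
    ... | inj₁ r with o₁ r
    ...   | inj₁ (here e) = ⊥-elim (n e)
    ...   | inj₂ s = #-sym (a₁₃ s q)
  ... | ts₃ , g₃ , i₃ , j₃ , o₃ with Legs.leg-end _ L₁ | Legs.leg-end⁺ _ L₂ | Legs.leg-end⁺ _ L₃
  ... | e₁ , z₁ , p₁ | e₂ , z₂ , p₂ | e₃ , z₃ , p₃ =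
    ℕₚ.<⇒≱ (three-members (Z Sub.∩ set ts₃) (mem z₁ (in₁ p₁)) (mem z₂ (i₃ (j₂ p₂))) (mem z₃ (j₃ p₃))
               (d p₁ L₂ (λ q → a₁₂ q) p₂) (d p₁ L₃ (λ q → a₁₃ q) p₃) (proj₁ (a₂₃ p₂ p₃)))
            (con (set ts₃) (grow-tree g₃))
    where
    open Legs (Sub._∈ Z)
    mem : ∀ {x} → x Sub.∈ Z → x ∈ ts₃ → x Sub.∈ Z Sub.∩ set ts₃
    mem p q = Subₚ.x∈p∩q⁺ (p , ∈-set⁺ q)
    in₁ : ∀ {x} → x ∈ c ∷ l₁ → x ∈ ts₃
    in₁ (here refl) = i₃ (i₂ (i₁ (here refl)))
    in₁ (there q)   = i₃ (i₂ (j₁ q))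
    d : ∀ {x w l} → x ∈ c ∷ l₁ → Leg c l → Anti l₁ l → w ∈ l → x ≢ w
    d (here refl) L _ q = leg-∉ L q
    d (there p)   _ a q = proj₁ (a p q)

-- Classical reasoning under double negation.

module Classical where

  return : {P : Set} → P → ¬ ¬ P
  return p k = k p

  _>>=_ : {P Q : Set} → ¬ ¬ P → (P → ¬ ¬ Q) → ¬ ¬ Q
  (m >>= f) k = m (λ p → f p k)

  em : {P : Set} → ¬ ¬ (P ⊎ ¬ P)
  em k = k (inj₂ (k ∘ inj₁))

  ¬¬-All : {A : Set} {P : A → Set} {xs : List A} → All (λ x → ¬ ¬ P x) xs → ¬ ¬ All P xs
  ¬¬-All []       = return []
  ¬¬-All (p ∷ ps) = p >>= λ q → ¬¬-All ps >>= λ qs → return (q ∷ qs)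

  ¬¬-min : (P : ℕ → Set) → ¬ ¬ ((∀ n → ¬ P n) ⊎ (Σ ℕ λ n → P n × (∀ m → m < n → ¬ P m)))
  ¬¬-min P = em >>= λ where
      (inj₂ no-n)    → return (inj₁ λ n p → no-n (n , p))
      (inj₁ (n , p)) → least n p >>= λ r → return (inj₂ r)
    where
    Least : Set
    Least = Σ ℕ λ n → P n × (∀ m → m < n → ¬ P m)
    least : ∀ n → P n → ¬ ¬ Least
    least = <-rec (λ n → P n → ¬ ¬ Least) λ n rec p →
      em {Σ ℕ λ m → m < n × P m} >>= λ where
        (inj₁ (m , m<n , q)) → rec m<n q
        (inj₂ none)          → return (n , p , λ m m<n q → none (m , m<n , q))

open Classical public

module Sublists {A : Set} where

  AllPairs-⊆ : {R : A → A → Set} {xs ys : List A} → xs ⊆ ys → AllPairs R ys → AllPairs R xs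
  AllPairs-⊆ [] []                  = []
  AllPairs-⊆ (_ ∷ʳ s) (_ ∷ ps)      = AllPairs-⊆ s ps
  AllPairs-⊆ (refl ∷ s) (p ∷ ps)    = All-resp-⊆ s p ∷ AllPairs-⊆ s ps

  partition-⊎ : {P Q : A → Set} {xs : List A} → All (λ x → P x ⊎ Q x) xs →
    Σ (List A) λ ys → Σ (List A) λ zs → ys ⊆ xs × zs ⊆ xs × All P ys × All Q zs × length xs ≡ length ys + length zs
  partition-⊎ [] = [] , [] , [] , [] , [] , [] , refl
  partition-⊎ (inj₁ p ∷ ps) with partition-⊎ ps
  ... | ys , zs , s , s' , a , b , e = _ ∷ ys , zs , refl ∷ s , _ ∷ʳ s' , p ∷ a , b , cong suc e
  partition-⊎ (inj₂ q ∷ ps) with partition-⊎ ps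
  ... | ys , zs , s , s' , a , b , e =
    ys , _ ∷ zs , _ ∷ʳ s , refl ∷ s' , a , q ∷ b , trans (cong suc e) (≡-sym (ℕₚ.+-suc (length ys) _))

  split-at : ∀ n (xs : List A) → n ≤ length xs → Σ (List A) λ ys → Σ (List A) λ zs → xs ≡ ys ++ zs × length ys ≡ n
  split-at zero xs _ = [] , xs , refl , refl
  split-at (suc n) (x ∷ xs) (s≤s h) with split-at n xs h
  ... | ys , zs , refl , e = x ∷ ys , zs , refl , cong suc e

open Sublists public

-- Ramsey's theorem for lists.

ramsey-bound : ℕ → ℕ → ℕ
ramsey-bound zero    t       = 0
ramsey-bound (suc s) zero    = 0
ramsey-bound (suc s) (suc t) = suc (ramsey-bound s (suc t) + ramsey-bound (suc s) t)

ramsey : {A : Set} {E : A → A → Set} → (∀ x y → Dec (E x y)) → ∀ s t xs → ramsey-bound s t ≤ length xs →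
  (Σ (List A) λ ys → ys ⊆ xs × length ys ≡ s × AllPairs E ys) ⊎
  (Σ (List A) λ ys → ys ⊆ xs × length ys ≡ t × AllPairs (λ x y → ¬ E x y) ys)
ramsey E? zero    t    xs _ = inj₁ ([] , minimum xs , refl , [])
ramsey E? (suc s) zero xs _ = inj₂ ([] , minimum xs , refl , [])
ramsey {A} {E} E? (suc s) (suc t) (x ∷ xs) (s≤s h) with partition-⊎ (All.universal dec xs)
  where
  dec : ∀ y → E x y ⊎ ¬ E x y
  dec y with E? x y
  ... | yes e = inj₁ e
  ... | no n  = inj₂ n
... | ys , zs , sy , sz , py , pz , e with ramsey-bound s (suc t) ℕₚ.≤? length ys
...   | yes big with ramsey E? s (suc t) ys big
...     | inj₁ (us , su , refl , c) = inj₁ (x ∷ us , refl ∷ ⊆-trans su sy , refl , All-resp-⊆ su py ∷ c)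
...     | inj₂ (us , su , l , c) = inj₂ (us , x ∷ʳ ⊆-trans su sy , l , c)
ramsey {A} {E} E? (suc s) (suc t) (x ∷ xs) (s≤s h) | ys , zs , sy , sz , py , pz , e | no small
  with ramsey E? (suc s) t zs
         (ℕₚ.≮⇒≥ λ lt → ℕₚ.<⇒≱ (ℕₚ.+-mono-<-≤ (ℕₚ.≰⇒> small) (ℕₚ.<⇒≤ lt)) (ℕₚ.≤-trans h (ℕₚ.≤-reflexive e)))
... | inj₁ (us , su , l , c) = inj₁ (us , x ∷ʳ ⊆-trans su sz , l , c)
... | inj₂ (us , su , refl , c) = inj₂ (x ∷ us , refl ∷ ⊆-trans su sz , refl , All-resp-⊆ su pz ∷ c)

-- Polynomial in `s` for fixed `t`; with `s` one more than the clique number, this is what makes the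
-- final bound a power of it.
ramsey-bound-≤ : ∀ s t → suc (ramsey-bound s t) ≤ suc s ^ t
ramsey-bound-≤ zero    t       = ℕₚ.≤-reflexive (≡-sym (ℕₚ.^-zeroˡ t))
ramsey-bound-≤ (suc s) zero    = s≤s z≤n
ramsey-bound-≤ (suc s) (suc t) = begin
  suc (suc (ramsey-bound s (suc t) + ramsey-bound (suc s) t))
    ≡⟨ cong suc (≡-sym (ℕₚ.+-suc _ _)) ⟩
  suc (ramsey-bound s (suc t)) + suc (ramsey-bound (suc s) t)
    ≤⟨ ℕₚ.+-mono-≤ (ramsey-bound-≤ s (suc t)) (ramsey-bound-≤ (suc s) t) ⟩
  suc s * suc s ^ t + suc (suc s) ^ t
    ≤⟨ ℕₚ.+-monoˡ-≤ _ (ℕₚ.*-monoʳ-≤ (suc s) (ℕₚ.^-monoˡ-≤ t (ℕₚ.n≤1+n (suc s)))) ⟩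
  suc s * suc (suc s) ^ t + suc (suc s) ^ t
    ≡⟨ ℕₚ.+-comm _ (suc (suc s) ^ t) ⟩
  suc (suc s) ^ suc t ∎
  where open ℕₚ.≤-Reasoning

-- First and last elements with a property, and positions in a list.

module ListSplits {A : Set} where

  LastSat FirstSat : (A → Set) → List A → Set
  LastSat D l = (∀ {x} → x ∈ l → ¬ D x) ⊎
    (Σ (List A) λ m → Σ A λ x → Σ (List A) λ s → l ≡ m ++ x ∷ s × D x × (∀ {y} → y ∈ s → ¬ D y))
  FirstSat D l = (∀ {x} → x ∈ l → ¬ D x) ⊎
    (Σ (List A) λ m → Σ A λ x → Σ (List A) λ s → l ≡ m ++ x ∷ s × (∀ {y} → y ∈ m → ¬ D y) × D x)

  lastSat : {D : A → Set} → (∀ x → Dec (D x)) → ∀ l → LastSat D l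
  lastSat D? [] = inj₁ λ ()
  lastSat D? (a ∷ l) with lastSat D? l
  ... | inj₂ (m , x , s , refl , d , r) = inj₂ (a ∷ m , x , s , refl , d , r)
  ... | inj₁ none with D? a
  ...   | yes d = inj₂ ([] , a , l , refl , d , none)
  ...   | no nd = inj₁ λ { (here refl) → nd ; (there p) → none p }

  firstSat : {D : A → Set} → (∀ x → Dec (D x)) → ∀ l → FirstSat D l
  firstSat D? [] = inj₁ λ ()
  firstSat D? (a ∷ l) with D? a
  ... | yes d = inj₂ ([] , a , l , refl , (λ ()) , d)
  ... | no nd with firstSat D? l
  ...   | inj₁ none = inj₁ λ { (here refl) → nd ; (there p) → none p }
  ...   | inj₂ (m , x , s , refl , r , d) =
    inj₂ (a ∷ m , x , s , refl , (λ { (here refl) → nd ; (there p) → r p }) , d)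

  ∈-split : ∀ {x : A} {l} → x ∈ l → Σ (List A) λ m → Σ (List A) λ s → l ≡ m ++ x ∷ s
  ∈-split (here refl) = [] , _ , refl
  ∈-split (there p) with ∈-split p
  ... | m , s , refl = _ ∷ m , s , refl

  ∈-mid : ∀ (m : List A) {x s} → x ∈ m ++ x ∷ s
  ∈-mid m = ∈-++⁺ʳ m (here refl)

  NE : List A → Set
  NE []      = ⊥
  NE (_ ∷ _) = ⊤

  -- Meant for two attachments to the same path. Of a later pair only `p' ∈ T` is kept: the
  -- attaching vertex is going to be known to have no neighbour in `T`.
  compare-splits : ∀ (l₁ : List A) {p p' l₂} m₁ {b c T} → l₁ ++ p ∷ p' ∷ l₂ ≡ m₁ ++ b ∷ c ∷ T →
    (length l₁ < length m₁ × Σ (List A) λ M → m₁ ++ b ∷ [] ≡ l₁ ++ p ∷ p' ∷ M × l₂ ≡ M ++ c ∷ T)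
    ⊎ (l₁ ≡ m₁ × p ≡ b × p' ≡ c × l₂ ≡ T)
    ⊎ (length m₁ < length l₁ × p' ∈ T)
  compare-splits [] [] refl = inj₂ (inj₁ (refl , refl , refl , refl))
  compare-splits [] (x ∷ []) refl = inj₁ (s≤s z≤n , [] , refl , refl)
  compare-splits [] (x ∷ y ∷ m₁) {b} refl = inj₁ (s≤s z≤n , m₁ ++ b ∷ [] , refl , ≡-sym (Listₚ.++-assoc m₁ _ _))
  compare-splits (x ∷ []) [] refl = inj₂ (inj₂ (s≤s z≤n , here refl))
  compare-splits (x ∷ y ∷ l₁) [] refl = inj₂ (inj₂ (s≤s z≤n , ∈-++⁺ʳ l₁ (there (here refl))))
  compare-splits (x ∷ l₁) (y ∷ m₁) e with Listₚ.∷-injective e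
  ... | refl , e' with compare-splits l₁ m₁ e'
  ...   | inj₁ (lt , M , q , r) = inj₁ (s≤s lt , M , cong (x ∷_) q , r)
  ...   | inj₂ (inj₁ (refl , r)) = inj₂ (inj₁ (refl , r))
  ...   | inj₂ (inj₂ (lt , q)) = inj₂ (inj₂ (s≤s lt , q))

open ListSplits public

-- Surgery on legs, and how a leg meets a Z-path.

module Core (G : Graph) (Z : V G → Set) (spider : Basics.Legs.Spiderless G Z) where

  open Basics G public
  open Legs Z public

  VL : Set
  VL = List (V G)

  _⋕?_ : ∀ x l → Dec (x ⋕ l)
  x ⋕? [] = yes λ ()
  x ⋕? (y ∷ l) with x #? y | x ⋕? l
  ... | yes p | yes q = yes λ { (here refl) → p ; (there r) → q r }
  ... | no np | _     = no λ h → np (h (here refl))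
  ... | _     | no nq = no λ h → nq (λ r → h (there r))

  ¬?_ : {P : Set} → Dec P → Dec (¬ P)
  ¬? yes p = no λ n → n p
  ¬? no np = yes np

  stable# : ∀ {x y} → ¬ ¬ (x # y) → x # y
  stable# {x} {y} h with x #? y
  ... | yes p = p
  ... | no np = ⊥-elim (h np)

  stable⋕ : ∀ {x l} → ¬ ¬ (x ⋕ l) → x ⋕ l
  stable⋕ {x} {l} h with x ⋕? l
  ... | yes p = p
  ... | no np = ⊥-elim (h np)

  _~?_ : ∀ x y → Dec (x ~ y)
  x ~? y with adj G x y
  ... | true  = yes refl
  ... | false = no λ ()

  leg-tail : ∀ {x} m {y s} → Leg x (m ++ y ∷ s) → Leg y s
  leg-tail [] (step _ _ l)      = l
  leg-tail (_ ∷ m) (step _ _ l) = leg-tail m l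

  leg-sep : ∀ {x} m {y s} → Leg x (m ++ y ∷ s) → Anti (x ∷ m) s
  leg-sep [] (step _ f _) (here refl) q = f q
  leg-sep (_ ∷ m) (step _ f _) (here refl) q = f (∈-++⁺ʳ m (there q))
  leg-sep (_ ∷ m) (step _ _ l) (there p) q = leg-sep m l p q

  leg-replace : ∀ {x} m {y s s'} → Leg x (m ++ y ∷ s) → Leg y s' → Anti (x ∷ m) s' → Leg x (m ++ y ∷ s')
  leg-replace [] (step a _ _) l' f = step a (f (here refl)) l'
  leg-replace {x} (b ∷ m) {y} {s} {s'} (step a g l) l' f = step a far (leg-replace m l l' (λ p → f (there p)))
    where
    far : x ⋕ (m ++ y ∷ s')
    far p with ∈-++⁻ m p
    ... | inj₁ q           = g (∈-++⁺ˡ q)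
    ... | inj₂ (here refl) = g (∈-++⁺ʳ m (here refl))
    ... | inj₂ (there q)   = f (here refl) q

  leg-cut : ∀ {x l} → Leg x l → ∀ m {y s} → x ∷ l ≡ m ++ y ∷ s → Leg y s
  leg-cut L [] refl      = L
  leg-cut L (_ ∷ m) refl = leg-tail m L

  -- Jumping from `k` to its last neighbour on the leg leaves nothing further that `k` could touch,
  -- so the result is induced.
  leg-hit : ∀ {x l k} → Leg x l → (∀ {y} → y ∈ l → k ≢ y) → ¬ (k ⋕ l) →
            Σ (V G) λ d → Σ VL λ s → Leg k (d ∷ s) × (∀ {y} → y ∈ d ∷ s → y ∈ l)
  leg-hit {x} {l} {k} L ne h with lastSat (λ y → ¬? (k #? y)) l
  ... | inj₁ none = ⊥-elim (h λ p → stable# (none p))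
  ... | inj₂ (m , d , s , refl , td , far) =
    d , s , step (¬#⇒~ td (ne (∈-mid m))) (λ p → stable# (far p)) (leg-tail m L) , λ p → ∈-++⁺ʳ m p

  leg-prepend : ∀ {x y l} → Leg y l → x ~ y → Σ VL λ l' → Leg x l' × (∀ {z} → z ∈ l' → z ∈ y ∷ l)
  leg-prepend {x} {y} {l} L a with lastSat (λ z → ¬? (x #? z)) (y ∷ l)
  ... | inj₁ none = ⊥-elim (none (here refl) λ h → #⇒≁ h a)
  ... | inj₂ (m , d , s , e , td , far) with x ≟ d
  ...   | yes refl = s , leg-cut L m e , λ p → subst (_ ∈_) (≡-sym e) (∈-++⁺ʳ m (there p))
  ...   | no  n    = d ∷ s , step (¬#⇒~ td n) (λ p → stable# (far p)) (leg-cut L m e) ,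
                     λ p → subst (_ ∈_) (≡-sym e) (∈-++⁺ʳ m p)

  -- The way from `k` back along `pre` to `v` and out along `Y`, shortened at each step to stay
  -- induced. It supplies a leg at `k` that does not use `post`.
  carry : ∀ pre {v k post Y} → Leg v (pre ++ k ∷ post) → Leg v Y →
          Σ VL λ l → Leg k l × (∀ {z} → z ∈ l → z ∈ pre ⊎ z ∈ v ∷ Y)
  carry [] (step a _ _) L with leg-prepend L (~-sym a)
  ... | l , L' , i = l , L' , λ p → inj₂ (i p)
  carry (x ∷ pre) (step a _ Q) L with leg-prepend L (~-sym a)
  ... | l₀ , L₀ , i₀ with carry pre Q L₀
  ...   | l , L' , i = l , L' , out
    where
    out : ∀ {z} → z ∈ l → z ∈ x ∷ pre ⊎ z ∈ _
    out p with i p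
    ... | inj₁ q           = inj₁ (there q)
    ... | inj₂ (here refl) = inj₁ (here refl)
    ... | inj₂ (there q)   = inj₂ (i₀ q)

  -- An induced path with both ends in Z, seen from one of its vertices.
  record DL (v : V G) (A B : VL) : Set where
    constructor dl
    field
      legA : Leg v A
      legB : Leg v B
      anti : Anti A B
  open DL public

  swap : ∀ {v A B} → DL v A B → DL v B A
  swap (dl a b t) = dl b a (Anti-sym t)

  shift : ∀ {v A b B} → DL v A (b ∷ B) → DL b (v ∷ A) B
  shift (dl a (step e f b) t) =
    dl (step (~-sym e) (λ p → #-sym (t p (here refl))) a) b
       λ { (here refl) q → f q ; (there p) q → t p (there q) }

  -- The neighbours of u in l are exactly the vertices in positions n and n + 1.
  record Split (u : V G) (l : VL) (n : ℕ) : Set where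
    constructor split
    field
      l₁    : VL
      p p'  : V G
      l₂    : VL
      eq    : l ≡ l₁ ++ p ∷ p' ∷ l₂
      len   : length l₁ ≡ n
      far₁  : u ⋕ l₁
      adj₁  : u ~ p
      adj₂  : u ~ p'
      far₂  : u ⋕ l₂

  -- The viewpoint `v` moves along `B` until it touches `τ`. If the last neighbour of `τ` on `B` is
  -- not next to `v`, the legs through `v`, through that neighbour and along `ω` form a spider at
  -- `τ`. If there is none on `B`, the two ends of the path and `τ ∷ ω` form a spider at `v`.
  attach-right : ∀ {v A B τ ω} → DL v A B → NE A ⊎ NE B → Leg τ ω → Anti ω (v ∷ A) → Anti ω (v ∷ B) →
                 (∀ {y} → y ∈ v ∷ B → τ ≢ y) → τ ⋕ A → ¬ (τ ⋕ (v ∷ B)) → Σ ℕ (Split τ (v ∷ B))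
  attach-right {v} {A} {B} {τ} {ω} D ne L aA aB nB fA h with τ #? v
  attach-right {v} {A} {[]} {τ} {ω} D ne L aA aB nB fA h | yes f = ⊥-elim (h λ { (here refl) → f })
  attach-right {v} {A} {b ∷ B} {τ} {ω} D ne L aA aB nB fA h | yes f
    with attach-right (shift D) (inj₁ tt) L
           (λ { p (here refl) → aB p (there (here refl)) ; p (there q) → aA' p q })
           (λ p q → aB p (there q)) (λ q → nB (there q))
           (λ { (here refl) → f ; (there q) → fA q }) (λ g → h λ { (here refl) → f ; (there q) → g q })
    where
    aA' : ∀ {x y} → x ∈ ω → y ∈ v ∷ A → x # y
    aA' = aA
  ... | n , split l₁ p p' l₂ e le f₁ a₁ a₂ f₂ =
    suc n , split (v ∷ l₁) p p' l₂ (cong (v ∷_) e) (cong suc le) (λ { (here refl) → f ; (there q) → f₁ q }) a₁ a₂ f₂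
  attach-right {v} {A} {B} {τ} {ω} D ne L aA aB nB fA h | no nf with lastSat (λ y → ¬? (τ #? y)) B
  ... | inj₂ ([] , b , B' , refl , tb , far) =
    0 , split [] v b B' refl refl (λ ()) (¬#⇒~ nf (nB (here refl))) (¬#⇒~ tb (nB (there (here refl)))) (λ p → stable# (far p))
  ... | inj₂ (c ∷ m , b , B' , refl , tb , far) =
    ⊥-elim (spider L
      (step τ~v fA (legA D))
      (step (¬#⇒~ tb (nB (there (∈-mid (c ∷ m))))) (λ p → stable# (far p)) (leg-tail (c ∷ m) (legB D)))
      aA
      (λ p q → aB p (there (∈-++⁺ʳ (c ∷ m) q)))
      sep)
    where
    τ~v : τ ~ v
    τ~v = ¬#⇒~ nf (nB (here refl))
    sep : Anti (v ∷ A) (b ∷ B')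
    sep (there p) q = anti D p (∈-++⁺ʳ (c ∷ m) q)
    sep (here refl) q with legB D
    ... | step _ f _ = f (∈-++⁺ʳ m q)
  ... | inj₁ none = ⊥-elim (go A B ne D aA aB fA (λ p → stable# (none p)))
    where
    v~τ : v ~ τ
    v~τ = ~-sym (¬#⇒~ nf (nB (here refl)))
    -- If `v` is an end of the path, the empty side has to serve as the first leg of the spider, the
    -- only one that may be empty.
    go : ∀ A B → NE A ⊎ NE B → DL v A B → Anti ω (v ∷ A) → Anti ω (v ∷ B) → τ ⋕ A → τ ⋕ B → ⊥
    go (a ∷ A) B _ D aA aB fA fB = spider (legB D) (legA D) (step v~τ (λ p → #-sym (aB p (here refl))) L)
      (Anti-sym (anti D)) (tauω fB (λ p q → aB p (there q))) (tauω fA (λ p q → aA p (there q)))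
      where
      tauω : ∀ {l} → τ ⋕ l → Anti ω l → Anti l (τ ∷ ω)
      tauω f a p (here refl) = #-sym (f p)
      tauω f a p (there q)   = #-sym (a q p)
    go [] (b ∷ B) _ D aA aB fA fB = spider (legA D) (legB D) (step v~τ (λ p → #-sym (aB p (here refl))) L)
      (λ ()) (λ ()) λ { p (here refl) → #-sym (fB p) ; p (there q) → #-sym (aB q (there p)) }
    go [] [] (inj₁ ()) D aA aB fA fB
    go [] [] (inj₂ ()) D aA aB fA fB

  -- In all other cases there is a subdivided claw with its three leaves in Z.
  attach : ∀ {v A B τ ω} → DL v A B → NE A ⊎ NE B → Leg τ ω → Anti ω (v ∷ A) → Anti ω (v ∷ B) →
           (∀ {y} → y ∈ v ∷ A → τ ≢ y) → (∀ {y} → y ∈ v ∷ B → τ ≢ y) → ¬ (τ ⋕ (v ∷ A) × τ ⋕ (v ∷ B)) →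
           (Σ ℕ (Split τ (v ∷ B)) × τ ⋕ A) ⊎ (Σ ℕ (Split τ (v ∷ A)) × τ ⋕ B)
  attach {v} {A} {B} {τ} D ne L aA aB nA nB h with τ ⋕? A | τ ⋕? B
  ... | yes fA | _ = inj₁ (attach-right D ne L aA aB nB fA (λ g → h ((λ { (here refl) → g (here refl) ; (there q) → fA q }) , g)) , fA)
  ... | no _   | yes fB = inj₂ (attach-right (swap D) (sw ne) L aB aA nA fB (λ g → h (g , (λ { (here refl) → g (here refl) ; (there q) → fB q }))) , fB)
    where
    sw : NE A ⊎ NE B → NE B ⊎ NE A
    sw (inj₁ x) = inj₂ x
    sw (inj₂ x) = inj₁ x
  ... | no tA  | no tB with leg-hit (legA D) (λ p → nA (there p)) tA | leg-hit (legB D) (λ p → nB (there p)) tB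
  ...   | d , s , L₁ , i₁ | d' , s' , L₂ , i₂ =
    ⊥-elim (spider L L₁ L₂ (λ p q → aA p (there (i₁ q))) (λ p q → aB p (there (i₂ q))) (λ p q → anti D (i₁ p) (i₂ q)))

_<∞_ : ℕ → Maybe ℕ → Set
n <∞ nothing = ⊤
n <∞ just m  = n < m

-- Attachments, minimal configurations and what a crossing can look like.

module Attachments (G : Graph) (Z : V G → Set) (spider : Basics.Legs.Spiderless G Z) where

  open Core G Z spider public

  leg-consec : ∀ {x l} → Leg x l → ∀ l₁ {p p' l₂} → x ∷ l ≡ l₁ ++ p ∷ p' ∷ l₂ → p ~ p'
  leg-consec (step a _ _) [] refl = a
  leg-consec (step _ _ L) (_ ∷ l₁) e = leg-consec L l₁ (Listₚ.∷-injectiveʳ e)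
  leg-consec (end _) (_ ∷ []) ()
  leg-consec (end _) (_ ∷ _ ∷ _) ()

  ∈-pair₁ : ∀ {l : VL} l₁ {p p' l₂} → l ≡ l₁ ++ p ∷ p' ∷ l₂ → p ∈ l
  ∈-pair₁ l₁ refl = ∈-++⁺ʳ l₁ (here refl)

  ∈-pair₂ : ∀ {l : VL} l₁ {p p' l₂} → l ≡ l₁ ++ p ∷ p' ∷ l₂ → p' ∈ l
  ∈-pair₂ l₁ refl = ∈-++⁺ʳ l₁ (there (here refl))

  only : ∀ {τ e l} → (∀ {y} → y ∈ l → y ≢ e → τ # y) → ∀ {y} → y ∈ l → τ ~ y → y ≡ e
  only {e = e} f {y} q b with y ≟ e
  ... | yes r = r
  ... | no n  = ⊥-elim (#⇒≁ (f q n) b)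

  -- An attaching vertex has two consecutive neighbours on the path. They are adjacent, hence
  -- distinct, so they cannot both be `e`.
  attach-single : ∀ {v A B τ ω e} → DL v A B → NE A ⊎ NE B → Leg τ ω → Anti ω (v ∷ A) → Anti ω (v ∷ B) →
    e ∈ v ∷ A ⊎ e ∈ v ∷ B → τ ~ e →
    (∀ {y} → y ∈ v ∷ A → y ≢ e → τ # y) → (∀ {y} → y ∈ v ∷ B → y ≢ e → τ # y) → ⊥
  attach-single {v} {A} {B} {τ} {ω} {e} D ne L aA aB e∈ a fA fB with attach D ne L aA aB (nq fA) (nq fB) (touch e∈)
    where
    nq : ∀ {l} → (∀ {y} → y ∈ l → y ≢ e → τ # y) → ∀ {y} → y ∈ l → τ ≢ y
    nq f {y} p with y ≟ e
    ... | yes refl = ~⇒≢ a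
    ... | no n     = proj₁ (f p n)
    touch : e ∈ v ∷ A ⊎ e ∈ v ∷ B → ¬ (τ ⋕ (v ∷ A) × τ ⋕ (v ∷ B))
    touch (inj₁ p) (f , g) = #⇒≁ (f p) a
    touch (inj₂ p) (f , g) = #⇒≁ (g p) a
  ... | inj₁ ((_ , split l₁ p p' l₂ eq _ _ a₁ a₂ _) , _) =
    ~⇒≢ (leg-consec (legB D) l₁ eq) (trans (only fB (∈-pair₁ l₁ eq) a₁) (≡-sym (only fB (∈-pair₂ l₁ eq) a₂)))
  ... | inj₂ ((_ , split l₁ p p' l₂ eq _ _ a₁ a₂ _) , _) =
    ~⇒≢ (leg-consec (legA D) l₁ eq) (trans (only fA (∈-pair₁ l₁ eq) a₁) (≡-sym (only fA (∈-pair₂ l₁ eq) a₂)))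

  -- The leg u ∷ U attaches to the path formed by o, v and l₁ ++ p ∷ c ∷ T exactly in p and c.
  record Att (v : V G) (o l₁ : VL) (p c : V G) (T : VL) (u : V G) (U : VL) : Set where
    constructor att
    field
      leg  : Leg u U
      u-l₁ : u ⋕ l₁
      u~p  : u ~ p
      u~c  : u ~ c
      u-T  : u ⋕ T
      u-v  : u # v
      u-o  : u ⋕ o
      U-l  : Anti U (v ∷ l₁ ++ p ∷ c ∷ T)
      U-o  : Anti U o
  open Att public

  HasAtt : V G → VL → VL → ℕ → Set
  HasAtt v o l n = Σ VL λ l₁ → Σ (V G) λ p → Σ (V G) λ c → Σ VL λ T → Σ (V G) λ u → Σ VL λ U →
    l ≡ l₁ ++ p ∷ c ∷ T × length l₁ ≡ n × Att v o l₁ p c T u U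

  module _ {v o l₁ p c T u U} (D : DL v o (l₁ ++ p ∷ c ∷ T)) (a : Att v o l₁ p c T u U) where

    private
      L : Leg v (l₁ ++ p ∷ c ∷ T)
      L = legB D

    leg-pc : Leg p (c ∷ T)
    leg-pc = leg-tail l₁ L

    leg-c : Leg c T
    leg-c with leg-pc
    ... | step _ _ k = k

    p-T : p ⋕ T
    p-T with leg-pc
    ... | step _ f _ = f

    p~c : p ~ c
    p~c with leg-pc
    ... | step b _ _ = b

    vl₁-cT : Anti (v ∷ l₁) (c ∷ T)
    vl₁-cT = leg-sep l₁ L

    private
      U∋ : ∀ {x} → x ∈ U → ∀ {y} → y ∈ l₁ ++ p ∷ c ∷ T → x # y
      U∋ q r = U-l a q (there r)

      vl₁-uU : Anti (v ∷ l₁) (u ∷ U)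
      vl₁-uU (here refl) (here refl) = #-sym (u-v a)
      vl₁-uU (there q)   (here refl) = #-sym (u-l₁ a q)
      vl₁-uU (here refl) (there r)   = #-sym (U-l a r (here refl))
      vl₁-uU (there q)   (there r)   = #-sym (U∋ r (∈-++⁺ˡ q))

    -- Beyond `p` the two ends `c ∷ T` and `u ∷ U` may be exchanged: this is the path with the other
    -- end, and `alt-att` is the old end attached to it at the same position.
    alt-dl : DL v o (l₁ ++ p ∷ u ∷ U)
    alt-dl = dl (legA D) (leg-replace l₁ L (step (~-sym (u~p a)) (λ q → #-sym (U∋ q (∈-++⁺ʳ l₁ (here refl)))) (leg a)) vl₁-uU) sep
      where
      sep : Anti o (l₁ ++ p ∷ u ∷ U)
      sep x y with ∈-++⁻ l₁ y
      ... | inj₁ q                   = anti D x (∈-++⁺ˡ q)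
      ... | inj₂ (here refl)         = anti D x (∈-++⁺ʳ l₁ (here refl))
      ... | inj₂ (there (here refl)) = #-sym (u-o a x)
      ... | inj₂ (there (there q))   = #-sym (U-o a q x)

    alt-att : Att v o l₁ p u U c T
    alt-att = att leg-c (λ q → #-sym (vl₁-cT (there q) (here refl))) (~-sym p~c) (~-sym (u~c a))
      (λ q → #-sym (U∋ q (∈-++⁺ʳ l₁ (there (here refl))))) (#-sym (vl₁-cT (here refl) (here refl)))
      (λ q → #-sym (anti D q (∈-++⁺ʳ l₁ (there (here refl))))) far (λ q r → #-sym (anti D r (∈-++⁺ʳ l₁ (there (there q)))))
      where
      far : Anti T (v ∷ l₁ ++ p ∷ u ∷ U)
      far x (here refl) = #-sym (vl₁-cT (here refl) (there x))
      far x (there y) with ∈-++⁻ l₁ y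
      ... | inj₁ q                   = #-sym (vl₁-cT (there q) (there x))
      ... | inj₂ (here refl)         = #-sym (p-T x)
      ... | inj₂ (there (here refl)) = #-sym (u-T a x)
      ... | inj₂ (there (there q))   = #-sym (U∋ q (∈-++⁺ʳ l₁ (there (there x))))

    -- The triangle `p`, `c`, `u` yields a third Z-path, which joins the two ends directly and
    -- avoids `p` and `v`.
    corner-dl : DL c (u ∷ U) T
    corner-dl = dl (step (~-sym (u~c a)) (λ q → #-sym (U∋ q (∈-++⁺ʳ l₁ (there (here refl))))) (leg a)) leg-c
      λ { (here refl) q → u-T a q ; (there r) q → U∋ r (∈-++⁺ʳ l₁ (there (there q))) }

    -- u cannot be the only neighbour of a leg on the path T, c, u, U.
    corner-clean : ∀ {τ ω} → Leg τ ω → Anti (τ ∷ ω) (c ∷ T) → Anti (τ ∷ ω) U → (∀ {x} → x ∈ τ ∷ ω → x ≢ u) → u ⋕ (τ ∷ ω)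
    corner-clean {τ} {ω} L' fcT fU ne with lastSat (λ y → ¬? (u #? y)) (τ ∷ ω)
    ... | inj₁ none = λ q → stable# (none q)
    ... | inj₂ (m , g , s , e , tg , far) = ⊥-elim (attach-single corner-dl (inj₁ tt) (leg-cut L' m e)
        (λ { q (here refl) → fcT (in-s q) (here refl) ; q (there (here refl)) → #-sym (stable# (far q)) ; q (there (there r)) → fU (in-s q) r })
        (λ q r → fcT (in-s q) r) (inj₁ (there (here refl)))
        (~-sym (¬#⇒~ tg (λ q → ne g∈ (≡-sym q))))
        (λ { (here refl) _ → fcT g∈ (here refl) ; (there (here refl)) n → ⊥-elim (n refl) ; (there (there r)) _ → fU g∈ r })
        (λ r _ → fcT g∈ r))
      where
      in-s : ∀ {x} → x ∈ s → x ∈ τ ∷ ω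
      in-s q = subst (_ ∈_) (≡-sym e) (∈-++⁺ʳ m (there q))
      g∈ : g ∈ τ ∷ ω
      g∈ = subst (_ ∈_) (≡-sym e) (∈-++⁺ʳ m (here refl))

  First : V G → VL → Set
  First α l = Σ VL λ l' → l ≡ α ∷ l'

  first-replace : ∀ {α} l₁ {p R R'} → First α (l₁ ++ p ∷ R) → First α (l₁ ++ p ∷ R')
  first-replace [] (_ , refl)      = _ , refl
  first-replace (_ ∷ l₁) (_ , refl) = _ , refl

  first-NE : ∀ {α l} → First α l → NE l
  first-NE (_ , refl) = tt

  data Side (v : V G) (o : VL) : VL → Maybe ℕ → Set where
    triv : ∀ {l} → Side v o l nothing
    real : ∀ l₁ p c T u U → Att v o l₁ p c T u U → Side v o (l₁ ++ p ∷ c ∷ T) (just (length l₁))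

  HasSide : V G → VL → VL → Maybe ℕ → Set
  HasSide v o l nothing  = ⊤
  HasSide v o l (just n) = HasAtt v o l n

  -- The two ways to continue beyond p: along the path itself, or along the attached leg.
  data Opt {v o} : ∀ {l N} → Side v o l N → VL → Set where
    own : ∀ {l N} {s : Side v o l N} → Opt s l
    alt : ∀ {l₁ p c T u U a} → Opt (real l₁ p c T u U a) (l₁ ++ p ∷ u ∷ U)

  tailOf : ∀ {v o l N} {s : Side v o l N} {Y} → Opt s Y → VL
  tailOf {s = triv} own = []
  tailOf {s = real _ _ _ T _ _ _} own = T
  tailOf (alt {U = U}) = U

  bey₁ bey₂ corners : ∀ {v o l N} → Side v o l N → VL
  bey₁ triv = []
  bey₁ (real _ _ _ T _ _ _) = T
  bey₂ triv = []
  bey₂ (real _ _ _ _ _ U _) = U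
  corners triv = []
  corners (real _ _ c _ u _ _) = c ∷ u ∷ []

  CornerHit : ∀ {v o l N} {s : Side v o l N} {Y} → Opt s Y → V G → Set
  CornerHit {s = triv} own σ = ⊥
  CornerHit {s = real _ p c T _ _ _} own σ = σ ~ p × σ ~ c × σ ⋕ T
  CornerHit (alt {p = p} {u = u} {U = U}) σ = σ ~ p × σ ~ u × σ ⋕ U

  opt-dl : ∀ {v o l N} {s : Side v o l N} {Y} → DL v o l → Opt s Y → DL v o Y
  opt-dl D own = D
  opt-dl D (alt {a = a}) = alt-dl D a

  opt-first : ∀ {v o l N β} {s : Side v o l N} {Y} → Opt s Y → First β l → First β Y
  opt-first own f = f
  opt-first (alt {l₁}) f = first-replace l₁ f

  opt-side : ∀ {v o l N} {s : Side v o l N} {Y} → DL v o l → Opt s Y → HasSide v o Y N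
  opt-side {s = triv} D own = tt
  opt-side {s = real _ _ _ _ _ _ a} D own = _ , _ , _ , _ , _ , _ , refl , refl , a
  opt-side D (alt {l₁} {a = a}) = _ , _ , _ , _ , _ , _ , refl , refl , alt-att D a

  -- Attaching later than the corner would put the second neighbour of `τ` into the tail that it
  -- avoids. On a trivial side every position counts as closer.
  position : ∀ {v o l N} {s : Side v o l N} {Y τ n} (y : Opt s Y) → Split τ Y n → τ ⋕ tailOf y → n <∞ N ⊎ CornerHit y τ
  position {s = triv} own _ _ = inj₁ tt
  position {s = real m₁ b c T u U a} own (split l₁ p p' l₂ e refl f₁ a₁ a₂ f₂) h with compare-splits l₁ m₁ (≡-sym e)
  ... | inj₁ (lt , _) = inj₁ lt
  ... | inj₂ (inj₁ (refl , refl , refl , refl)) = inj₂ (a₁ , a₂ , f₂)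
  ... | inj₂ (inj₂ (_ , q)) = ⊥-elim (#⇒≁ (h q) a₂)
  position (alt {m₁}) (split l₁ p p' l₂ e refl f₁ a₁ a₂ f₂) h with compare-splits l₁ m₁ (≡-sym e)
  ... | inj₁ (lt , _) = inj₁ lt
  ... | inj₂ (inj₁ (refl , refl , refl , refl)) = inj₂ (a₁ , a₂ , f₂)
  ... | inj₂ (inj₂ (_ , q)) = ⊥-elim (#⇒≁ (h q) a₂)

  split-att : ∀ {v X Y τ ω n} → Split τ Y n → Leg τ ω → Anti ω (v ∷ X) → Anti ω (v ∷ Y) → τ # v → τ ⋕ X → HasAtt v X Y n
  split-att (split l₁ p p' l₂ refl le f₁ a₁ a₂ f₂) L aX aY tv tX =
    l₁ , p , p' , l₂ , _ , _ , refl , le , att L f₁ a₁ a₂ f₂ tv tX aY (λ q r → aX q (there r))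

  -- A configuration at v minimises first the distance from v to an attachment on the B side,
  -- then the distance to an attachment on the A side; nothing means that there is no attachment.
  record Cfg (v α β : V G) {A B N K} (sL : Side v B A K) (sR : Side v A B N) : Set where
    field
      D     : DL v A B
      fA    : First α A
      fB    : First β B
      minR  : ∀ {A' B' n} → n <∞ N → DL v A' B' → First α A' → First β B' → HasAtt v A' B' n → ⊥
      minL  : ∀ {A' B' k} → k <∞ K → DL v A' B' → First α A' → First β B' → HasSide v A' B' N → HasAtt v B' A' k → ⊥

  -- The rest of a path from its last contact with the Z-path X, v, Y onwards: only `σ` can still
  -- touch that Z-path.
  record Hit (v : V G) (X Y : VL) (σ : V G) : Set where
    constructor hit
    field
      ω   : VL
      leg : Leg σ ω
      ωX  : Anti ω (v ∷ X)
      ωY  : Anti ω (v ∷ Y)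
      σ∉X : ∀ {y} → y ∈ v ∷ X → σ ≢ y
      σ∉Y : ∀ {y} → y ∈ v ∷ Y → σ ≢ y

  -- Taking both attached legs at once is left out: there may be edges between them, and then the
  -- path is not induced.
  data Ok {v A B N K} {sL : Side v B A K} {sR : Side v A B N} : ∀ {X Y} → Opt sL X → Opt sR Y → Set where
    ok₁ : ∀ {Y} {y : Opt sR Y} → Ok own y
    ok₂ : ∀ {X} {x : Opt sL X} → Ok x own

  -- The left and the right leg may touch each other, so a path leaving along the left leg
  -- need not keep the right attachment: legs attached to it must avoid the right leg.
  Extra : ∀ {v A B N K} {sL : Side v B A K} (sR : Side v A B N) {X} → Opt sL X → V G → Set
  Extra sR own z = ⊤
  Extra sR alt z = z ⋕ bey₂ sR

  ok-dl : ∀ {v A B N K} {sL : Side v B A K} {sR : Side v A B N} {X Y} {x : Opt sL X} {y : Opt sR Y} →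
          DL v A B → Ok x y → DL v X Y
  ok-dl {y = y} D ok₁ = opt-dl D y
  ok-dl {x = x} D ok₂ = swap (opt-dl (swap D) x)

  -- Crossings at the right corner, at the left corner, and at v on the β side and on the α side.
  data Ev (v α β : V G) {A B N K} (sL : Side v B A K) (sR : Side v A B N) (σ : V G) : Set where
    evR : ∀ {X Y} {x : Opt sL X} {y : Opt sR Y} → Ok x y → (h : Hit v X Y σ) →
          (∀ {z} → z ∈ σ ∷ Hit.ω h → Extra sR x z) → CornerHit y σ → σ # v → σ ⋕ X → Σ ℕ (Split σ Y) → Ev v α β sL sR σ
    evL : ∀ {X Y} {x : Opt sL X} {y : Opt sR Y} → Ok x y → (h : Hit v X Y σ) →
          (∀ {z} → z ∈ σ ∷ Hit.ω h → Extra sR x z) → CornerHit x σ → σ # v → σ ⋕ Y → Σ ℕ (Split σ X) → Ev v α β sL sR σ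
    ev+ : ∀ {X ω} → First α X → DL v X (σ ∷ ω) → σ ~ β → σ # α → Ev v α β sL sR σ
    ev- : ∀ {Y ω} → First β Y → DL v (σ ∷ ω) Y → σ ~ α → σ # β → Ev v α β sL sR σ

  -- The new vertices of the left arm miss `B` and `U` by assumption. The remaining danger is an
  -- edge from `u` to them, and `corner-clean` rules it out.
  keep-right : ∀ {v A B N A' τ ω} (sR : Side v A B N) → DL v A B → (∀ {z} → z ∈ A' → z ∈ A ⊎ z ∈ τ ∷ ω) →
               Leg τ ω → Anti (τ ∷ ω) B → (∀ {z} → z ∈ τ ∷ ω → z ⋕ bey₂ sR) → HasSide v A' B N
  keep-right triv D sub L tB ex = tt
  keep-right {v} {A} {A' = A'} {τ} {ω} (real l₁ p c T u U a) D sub L tB ex =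
    l₁ , p , c , T , u , U , refl , refl ,
    att (leg a) (u-l₁ a) (u~p a) (u~c a) (u-T a) (u-v a) uA' (U-l a) UA'
    where
    clean : u ⋕ (τ ∷ ω)
    clean = corner-clean D a L (λ q r → tB q (∈-++⁺ʳ l₁ (there r))) (λ q r → ex q r)
              (λ { q refl → #⇒≁ (tB q (∈-++⁺ʳ l₁ (here refl))) (u~p a) })
    uA' : u ⋕ A'
    uA' q with sub q
    ... | inj₁ r = u-o a r
    ... | inj₂ r = clean r
    UA' : Anti U A'
    UA' x q with sub q
    ... | inj₁ r = U-o a x r
    ... | inj₂ r = #-sym (ex r x)

  -- A left attachment closer to v than the chosen one, on the path leaving along the left leg:
  -- the path through τ ∷ ω keeps the right attachment and has the rest of the old path as left leg.
  reroute : ∀ {v α A B N m₁ a w W τ ω n} (sR : Side v A B N) → DL v A B →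
            DL v (m₁ ++ a ∷ w ∷ W) B → First α (m₁ ++ a ∷ w ∷ W) →
            Leg τ ω → Anti ω (v ∷ m₁ ++ a ∷ w ∷ W) → Anti ω (v ∷ B) → τ # v → τ ⋕ B →
            (∀ {z} → z ∈ τ ∷ ω → z ⋕ bey₂ sR) → (∀ {z} → z ∈ m₁ ++ a ∷ [] → z ∈ A) →
            Split τ (m₁ ++ a ∷ w ∷ W) n → n < length m₁ →
            Σ VL λ A' → DL v A' B × First α A' × HasSide v A' B N × HasAtt v B A' n
  reroute {m₁ = m₁} sR D D' f L aX aY tv tB ex sub (split l₁ r l l₂ eq refl f₁ a₁ a₂ f₂) lt
    with compare-splits l₁ m₁ (≡-sym eq)
  ... | inj₂ (inj₁ (refl , _)) = ⊥-elim (ℕₚ.<-irrefl refl lt)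
  ... | inj₂ (inj₂ (gt , _)) = ⊥-elim (ℕₚ.<-asym lt gt)
  reroute {v} {α} {A} {B} {N} {m₁} {τ = τ} {ω} sR D D' f L aX aY tv tB ex sub (split l₁ r l l₂ eq refl f₁ a₁ a₂ f₂) lt | inj₁ (_ , M , e₁ , _) =
    A' , dl leg' (legB D) antiA'B , first-replace l₁ (subst (First α) eq f) ,
    keep-right sR D sub' L (λ { (here refl) q → tB q ; (there p) q → aY p (there q) }) ex ,
    l₁ , r , τ , ω , l , l₂ , refl , refl ,
    att legl (λ q → #-sym (sep (there q) (here refl))) (~-sym r~l) (~-sym a₂)
      (λ q → #-sym (aX' q (there (∈-++⁺ʳ l₁ (there (here refl)))))) (#-sym (sep (here refl) (here refl)))
      (λ q → anti D'' (∈-++⁺ʳ l₁ (there (here refl))) q) far (λ p q → anti D'' (∈-++⁺ʳ l₁ (there (there p))) q)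
    where
    A' : VL
    A' = l₁ ++ r ∷ τ ∷ ω
    D'' : DL v (l₁ ++ r ∷ l ∷ l₂) B
    D'' = subst (λ t → DL v t B) eq D'
    aX' : Anti ω (v ∷ l₁ ++ r ∷ l ∷ l₂)
    aX' = subst (λ t → Anti ω (v ∷ t)) eq aX
    sep : Anti (v ∷ l₁) (l ∷ l₂)
    sep = leg-sep l₁ (legA D'')
    legr : Leg r (l ∷ l₂)
    legr = leg-tail l₁ (legA D'')
    legl : Leg l l₂
    legl with legr
    ... | step _ _ k = k
    r~l : r ~ l
    r~l with legr
    ... | step k _ _ = k
    r-l₂ : r ⋕ l₂
    r-l₂ with legr
    ... | step _ k _ = k
    vl₁-τω : Anti (v ∷ l₁) (τ ∷ ω)
    vl₁-τω (here refl) (here refl) = #-sym tv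
    vl₁-τω (there q)   (here refl) = #-sym (f₁ q)
    vl₁-τω (here refl) (there q)   = #-sym (aX' q (here refl))
    vl₁-τω (there p)   (there q)   = #-sym (aX' q (there (∈-++⁺ˡ p)))
    leg' : Leg v A'
    leg' = leg-replace l₁ (legA D'') (step (~-sym a₁) (λ q → #-sym (aX' q (there (∈-++⁺ʳ l₁ (here refl))))) L) vl₁-τω
    antiA'B : Anti A' B
    antiA'B p q with ∈-++⁻ l₁ p
    ... | inj₁ k                   = anti D'' (∈-++⁺ˡ k) q
    ... | inj₂ (here refl)         = anti D'' (∈-++⁺ʳ l₁ (here refl)) q
    ... | inj₂ (there (here refl)) = tB q
    ... | inj₂ (there (there k))   = aY k (there q)
    -- By `e₁` the part up to `r` lies in the beginning shared with `A`, so only `τ ∷ ω` is new.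
    sub' : ∀ {z} → z ∈ A' → z ∈ A ⊎ z ∈ τ ∷ ω
    sub' p with ∈-++⁻ l₁ p
    ... | inj₁ k           = inj₁ (sub (subst (_ ∈_) (≡-sym e₁) (∈-++⁺ˡ k)))
    ... | inj₂ (here refl) = inj₁ (sub (subst (_ ∈_) (≡-sym e₁) (∈-++⁺ʳ l₁ (here refl))))
    ... | inj₂ (there k)   = inj₂ k
    far : Anti l₂ (v ∷ l₁ ++ r ∷ τ ∷ ω)
    far p (here refl) = #-sym (sep (here refl) (there p))
    far p (there q) with ∈-++⁻ l₁ q
    ... | inj₁ k                   = #-sym (sep (there k) (there p))
    ... | inj₂ (here refl)         = #-sym (r-l₂ p)
    ... | inj₂ (there (here refl)) = #-sym (f₂ p)
    ... | inj₂ (there (there k))   = #-sym (aX' k (there (∈-++⁺ʳ l₁ (there (there p)))))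

  -- To contradict `minL`, the closer attachment must be on a path with a right attachment at
  -- distance `N`. With the original left arm this holds for either right option; with the left leg
  -- as arm it is restored by `reroute`.
  no-closer-left : ∀ {v α β A B N K} {sL : Side v B A K} {sR : Side v A B N} → Cfg v α β sL sR →
                   ∀ {X Y σ ω n} {x : Opt sL X} {y : Opt sR Y} → Ok x y → Leg σ ω → Anti ω (v ∷ X) → Anti ω (v ∷ Y) →
                   σ # v → σ ⋕ Y → (∀ {z} → z ∈ σ ∷ ω → Extra sR x z) → Split σ X n → n <∞ K → ⊥
  no-closer-left cfg {x = own} {y} ok₁ L ωX ωY tv tY ex sp lt =
    minL lt (opt-dl D y) fA (opt-first y fB) (opt-side D y) (split-att sp L ωY ωX tv tY)
    where open Cfg cfg
  no-closer-left {sR = sR} cfg {x = own} ok₂ L ωX ωY tv tY ex sp lt =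
    minL lt D fA fB (opt-side D (own {s = sR})) (split-att sp L ωY ωX tv tY)
    where open Cfg cfg
  no-closer-left {sR = sR} cfg {x = alt {m₁} {p} {c} {T} {a = a}} ok₂ L ωX ωY tv tY ex sp lt
    with reroute {m₁ = m₁} sR D (swap (alt-dl (swap D) a)) (first-replace m₁ fA) L ωX ωY tv tY ex sub sp lt
    where
    open Cfg cfg
    sub : ∀ {z} → z ∈ m₁ ++ p ∷ [] → z ∈ m₁ ++ p ∷ c ∷ T
    sub q with ∈-++⁻ m₁ q
    ... | inj₁ r           = ∈-++⁺ˡ r
    ... | inj₂ (here refl) = ∈-++⁺ʳ m₁ (here refl)
  ... | _ , D' , f' , s' , h' = Cfg.minL cfg lt D' f' (Cfg.fB cfg) s' h'

  -- An attachment strictly between v and a corner would contradict minimality.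
  classify : ∀ {v α β A B N K} {sL : Side v B A K} {sR : Side v A B N} → Cfg v α β sL sR →
             ∀ {X Y σ} {x : Opt sL X} {y : Opt sR Y} → Ok x y → (h : Hit v X Y σ) →
             (∀ {z} → z ∈ σ ∷ Hit.ω h → Extra sR x z) → σ ⋕ tailOf x → σ ⋕ tailOf y →
             ¬ (σ ⋕ (v ∷ X) × σ ⋕ (v ∷ Y)) → Ev v α β sL sR σ
  classify {v} {α} {β} {sL = sL} {sR} cfg {X} {Y} {σ} {x} {y} ok h@(hit ω L ωX ωY nX nY) ex fx fy touch
    with attach (ok-dl D ok) (inj₁ (first-NE (opt-first x fA))) L ωX ωY nX nY touch
    where open Cfg cfg
  -- Positions are counted in `v ∷ Y`, so an empty prefix means that `σ` attaches to `v` and `β`.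
  -- Dropping `v` below gives the position in `Y`.
  ... | inj₁ ((_ , split [] p p' l₂ refl _ _ a₁ a₂ f₂) , sX) with opt-first y (Cfg.fB cfg) | opt-first x (Cfg.fA cfg)
  ...   | (_ , refl) | fX@(_ , refl) = ev+ fX (dl (legA D') (step (~-sym a₁) (λ q → #-sym (ωX q (here refl))) L) sep) a₂ (sX (here refl))
    where
    D' : DL v X (p' ∷ l₂)
    D' = ok-dl (Cfg.D cfg) ok
    sep : Anti X (σ ∷ ω)
    sep p (here refl) = #-sym (sX p)
    sep p (there q)   = #-sym (ωX q (there p))
  classify {v} {sL = sL} {sR} cfg {X} {Y} {σ} {x} {y} ok h@(hit ω L ωX ωY nX nY) ex fx fy touch
    | inj₁ ((_ , split (_ ∷ l₁) p p' l₂ refl _ f₁ a₁ a₂ f₂) , sX)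
    with position y (split l₁ p p' l₂ refl refl (λ q → f₁ (there q)) a₁ a₂ f₂) fy
  ...   | inj₂ ch = evR ok h ex ch (f₁ (here refl)) sX (_ , split l₁ p p' l₂ refl refl (λ q → f₁ (there q)) a₁ a₂ f₂)
  ...   | inj₁ lt = ⊥-elim (minR lt (ok-dl D ok) (opt-first x fA) (opt-first y fB)
                      (split-att (split l₁ p p' l₂ refl refl (λ q → f₁ (there q)) a₁ a₂ f₂) L ωX ωY (f₁ (here refl)) sX))
    where open Cfg cfg
  classify {v} {α} {β} {sL = sL} {sR} cfg {X} {Y} {σ} {x} {y} ok h@(hit ω L ωX ωY nX nY) ex fx fy touch
    | inj₂ ((_ , split [] p p' l₂ refl _ _ a₁ a₂ f₂) , sY) with opt-first y (Cfg.fB cfg) | opt-first x (Cfg.fA cfg)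
  ...   | fY@(_ , refl) | (_ , refl) = ev- fY (dl (step (~-sym a₁) (λ q → #-sym (ωX q (here refl))) L) (legB D') sep) a₂ (sY (here refl))
    where
    D' : DL v (p' ∷ l₂) Y
    D' = ok-dl (Cfg.D cfg) ok
    sep : Anti (σ ∷ ω) Y
    sep (here refl) q = sY q
    sep (there p)   q = ωY p (there q)
  classify {v} {α} {β} {sL = sL} {sR} cfg {X} {Y} {σ} {x} {y} ok h@(hit ω L ωX ωY nX nY) ex fx fy touch
    | inj₂ ((_ , split (_ ∷ l₁) p p' l₂ refl _ f₁ a₁ a₂ f₂) , sY)
    with position x (split l₁ p p' l₂ refl refl (λ q → f₁ (there q)) a₁ a₂ f₂) fx
  ...   | inj₂ ch = evL ok h ex ch (f₁ (here refl)) sY (_ , split l₁ p p' l₂ refl refl (λ q → f₁ (there q)) a₁ a₂ f₂)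
  ...   | inj₁ lt = ⊥-elim (no-closer-left cfg ok L ωX ωY (f₁ (here refl)) sY ex
                      (split l₁ p p' l₂ refl refl (λ q → f₁ (there q)) a₁ a₂ f₂) lt)

-- Every path from v to Z crosses a minimal configuration.

module Crossings (G : Graph) (Z : V G → Set) (spider : Basics.Legs.Spiderless G Z) where

  open Attachments G Z spider public

  bey : ∀ {v o l N} → Side v o l N → VL
  bey s = bey₁ s ++ bey₂ s

  bey₁-sub : ∀ {v o l N} (s : Side v o l N) → ∀ {x} → x ∈ bey₁ s → x ∈ l
  bey₁-sub (real l₁ _ _ _ _ _ _) p = ∈-++⁺ʳ l₁ (there (there p))

  vo-bey₁ : ∀ {v o l N} → DL v o l → (s : Side v o l N) → Anti (v ∷ o) (bey₁ s)
  vo-bey₁ D (real l₁ _ _ _ _ _ a) (here refl) q = vl₁-cT D a (here refl) (there q)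
  vo-bey₁ D s@(real _ _ _ _ _ _ _) (there p) q = anti D p (bey₁-sub s q)

  vo-bey₂ : ∀ {v o l N} (s : Side v o l N) → Anti (v ∷ o) (bey₂ s)
  vo-bey₂ (real _ _ _ _ _ _ a) (here refl) q = #-sym (U-l a q (here refl))
  vo-bey₂ (real _ _ _ _ _ _ a) (there p)   q = #-sym (U-o a q p)

  vl-bey₂ : ∀ {v o l N} (s : Side v o l N) → Anti (v ∷ l) (bey₂ s)
  vl-bey₂ (real _ _ _ _ _ _ a) p q = #-sym (U-l a q p)

  bey₁-bey₂ : ∀ {v o l N} (s : Side v o l N) → Anti (bey₁ s) (bey₂ s)
  bey₁-bey₂ s p q = vl-bey₂ s (there (bey₁-sub s p)) q

  side-hit₁ : ∀ {v o l N k} → DL v o l → (s : Side v o l N) → (∀ {y} → y ∈ bey₁ s → k ≢ y) → ¬ (k ⋕ bey₁ s) →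
              Σ (V G) λ d → Σ VL λ t → Leg k (d ∷ t) × (∀ {y} → y ∈ d ∷ t → y ∈ bey₁ s)
  side-hit₁ D triv _ h = ⊥-elim (h λ ())
  side-hit₁ D (real _ _ _ _ _ _ a) ne h = leg-hit (leg-c D a) ne h

  side-hit₂ : ∀ {v o l N k} (s : Side v o l N) → (∀ {y} → y ∈ bey₂ s → k ≢ y) → ¬ (k ⋕ bey₂ s) →
              Σ (V G) λ d → Σ VL λ t → Leg k (d ∷ t) × (∀ {y} → y ∈ d ∷ t → y ∈ bey₂ s)
  side-hit₂ triv _ h = ⊥-elim (h λ ())
  side-hit₂ (real _ _ _ _ _ _ a) ne h = leg-hit (leg a) ne h

  -- When `k` touches the end of the path beyond the corner, the Z-path is led along the attached
  -- leg instead, which has no edges to that end. A trivial side has nothing beyond a corner.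
  other-exit : ∀ {v o l N} → DL v o l → (s : Side v o l N) → ∀ {k} → ¬ (k ⋕ bey₁ s) →
               Σ VL λ Y → Σ (Opt s Y) λ y → Anti (v ∷ Y) (bey₁ s) × (∀ {z} → z ∈ tailOf y → z ∈ bey₂ s)
  other-exit D triv h = ⊥-elim (h λ ())
  other-exit D (real l₁ p c T u U a) h = _ , alt , (λ q r → #-sym (U-l (alt-att D a) r q)) , id

  own-tail : ∀ {v o l N} {s : Side v o l N} {z} → z ∈ tailOf (own {s = s}) → z ∈ bey₁ s
  own-tail {s = real _ _ _ _ _ _ _} p = p

  leg-prev : ∀ pre {v k post} → Leg v (pre ++ k ∷ post) → Σ (V G) λ x → x ∈ v ∷ pre × x ~ k
  leg-prev [] (step a _ _) = _ , here refl , a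
  leg-prev (_ ∷ pre) (step _ _ L) with leg-prev pre L
  ... | x , p , a = x , there p , a

  leg-∉path : ∀ {τ y ω l} → Leg τ (y ∷ ω) → Anti (y ∷ ω) l → ∀ {x} → x ∈ l → τ ≢ x
  leg-∉path (step a _ _) f p refl = #⇒≁ (f (here refl) p) (~-sym a)

  record Crossing (v α β : V G) {A B N K} (sL : Side v B A K) (sR : Side v A B N) (qs : VL) : Set where
    constructor crossing
    field
      pre  : VL
      σ    : V G
      post : VL
      eq   : qs ≡ pre ++ σ ∷ post
      farR : Anti pre (bey sR)
      farL : Anti pre (bey sL)
      ev   : Ev v α β sL sR σ

  record LastTouch (v : V G) (X Y pre : VL) (k : V G) (ω₀ post : VL) : Set where
    constructor lastTouch
    field
      m      : VL
      τ      : V G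
      post'  : VL
      eq     : pre ++ k ∷ post ≡ m ++ τ ∷ post'
      m⊆     : ∀ {z} → z ∈ m → z ∈ pre
      τ∈     : τ ∈ pre ⊎ τ ≡ k
      hits   : Hit v X Y τ
      ω⊆     : ∀ {z} → z ∈ Hit.ω hits → z ∈ pre ++ k ∷ ω₀
      touch  : ¬ (τ ⋕ (v ∷ X) × τ ⋕ (v ∷ Y))

  -- After `k` the path is replaced by a leg that avoids the Z-path, so the last contact is `k` or
  -- earlier. There is one, because the first vertex is adjacent to `v`.
  last-touch : ∀ {v X Y} pre {k post d t} → Leg v (pre ++ k ∷ post) → Leg k (d ∷ t) → Anti (v ∷ pre) (d ∷ t) →
               Anti (d ∷ t) (v ∷ X) → Anti (d ∷ t) (v ∷ Y) → LastTouch v X Y pre k (d ∷ t) post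
  last-touch {v} {X} {Y} pre {k} {post} {d} {t} Q Lk vp aX aY with (k ⋕? (v ∷ X)) | (k ⋕? (v ∷ Y))
  ... | yes kX | yes kY = go (lastSat (λ z → ¬? (z ⋕? ((v ∷ X) ++ (v ∷ Y)))) pre)
    where
    L : Leg v (pre ++ k ∷ d ∷ t)
    L = leg-replace pre Q Lk vp
    starts : ∀ pre → Leg v (pre ++ k ∷ d ∷ t) → ¬ (∀ {z} → z ∈ pre → ¬ ¬ (z ⋕ ((v ∷ X) ++ (v ∷ Y))))
    starts [] (step a _ _) _ = #⇒≁ (kX (here refl)) (~-sym a)
    starts (q ∷ _) (step a _ _) h = h (here refl) λ f → #⇒≁ (f (here refl)) (~-sym a)
    go : LastSat (λ z → ¬ (z ⋕ ((v ∷ X) ++ (v ∷ Y)))) pre → LastTouch v X Y pre k (d ∷ t) post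
    go (inj₁ none) = ⊥-elim (starts pre L none)
    go (inj₂ (m , τ , s , refl , th , far)) =
      lastTouch m τ (s ++ k ∷ post) (Listₚ.++-assoc m (τ ∷ s) _) ∈-++⁺ˡ (inj₁ (∈-mid m))
        (hit (s ++ k ∷ d ∷ t) Lτ ωX ωY (τ∉ ωX) (τ∉ ωY))
        (λ q → subst (_ ∈_) (≡-sym (Listₚ.++-assoc m (τ ∷ s) _)) (∈-++⁺ʳ m (there q)))
        (λ { (f , g) → th (λ q → both f g (∈-++⁻ (v ∷ X) q)) })
      where
      both : ∀ {z} → τ ⋕ (v ∷ X) → τ ⋕ (v ∷ Y) → z ∈ v ∷ X ⊎ z ∈ v ∷ Y → τ # z
      both f g (inj₁ q) = f q
      both f g (inj₂ q) = g q
      Lτ : Leg τ (s ++ k ∷ d ∷ t)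
      Lτ = leg-tail m (subst (Leg v) (Listₚ.++-assoc m (τ ∷ s) _) L)
      ωX : Anti (s ++ k ∷ d ∷ t) (v ∷ X)
      ωX p q with ∈-++⁻ s p
      ... | inj₁ r           = stable⋕ (far r) (∈-++⁺ˡ q)
      ... | inj₂ (here refl) = kX q
      ... | inj₂ (there r)   = aX r q
      ωY : Anti (s ++ k ∷ d ∷ t) (v ∷ Y)
      ωY p q with ∈-++⁻ s p
      ... | inj₁ r           = stable⋕ (far r) (∈-++⁺ʳ (v ∷ X) q)
      ... | inj₂ (here refl) = kY q
      ... | inj₂ (there r)   = aY r q
      leg-next : ∀ s {τ e r} → Leg τ (s ++ e ∷ r) → Σ (V G) λ y → y ∈ s ++ e ∷ r × τ ~ y
      leg-next [] (step a _ _) = _ , here refl , a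
      leg-next (_ ∷ _) (step a _ _) = _ , here refl , a
      τ∉ : ∀ {l} → Anti (s ++ k ∷ d ∷ t) l → ∀ {z} → z ∈ l → τ ≢ z
      τ∉ f q refl with leg-next s Lτ
      ... | y , p , a = #⇒≁ (f p q) (~-sym a)
  ... | no kX | _ = lastTouch pre k post refl id (inj₂ refl) (hit (d ∷ t) Lk aX aY (leg-∉path Lk aX) (leg-∉path Lk aY))
      (λ q → ∈-++⁺ʳ pre (there q)) λ { (f , _) → kX f }
  ... | yes _ | no kY = lastTouch pre k post refl id (inj₂ refl) (hit (d ∷ t) Lk aX aY (leg-∉path Lk aX) (leg-∉path Lk aY))
      (λ q → ∈-++⁺ʳ pre (there q)) λ { (_ , g) → kY g }

  finish : ∀ {v α β A B N K} {sL : Side v B A K} {sR : Side v A B N} → Cfg v α β sL sR →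
    ∀ {X Y} {x : Opt sL X} {y : Opt sR Y} → Ok x y → ∀ pre {k post d t} → Leg v (pre ++ k ∷ post) →
    Anti pre (bey sR) → Anti pre (bey sL) → Leg k (d ∷ t) → Anti (v ∷ pre) (d ∷ t) →
    Anti (d ∷ t) (v ∷ X) → Anti (d ∷ t) (v ∷ Y) → k ⋕ tailOf x → k ⋕ tailOf y →
    (∀ {z} → z ∈ tailOf x → z ∈ bey sL) → (∀ {z} → z ∈ tailOf y → z ∈ bey sR) →
    (∀ {z} → z ∈ pre ++ k ∷ d ∷ t → Extra sR x z) → Crossing v α β sL sR (pre ++ k ∷ post)
  finish cfg {x = x} {y} ok pre {k} {d = d} {t} Q fR fL Lk vp aX aY kx ky tx ty ex with last-touch pre Q Lk vp aX aY
  ... | lastTouch m τ post' eq m⊆ τ∈ hits ω⊆ touch = crossing m τ post' eq (λ p → fR (m⊆ p)) (λ p → fL (m⊆ p))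
    (classify cfg ok hits (λ { (here refl) → ex (τ-in τ∈) ; (there p) → ex (ω⊆ p) }) (tail tx kx fL τ∈) (tail ty ky fR τ∈) touch)
    where
    τ-in : τ ∈ pre ⊎ τ ≡ k → τ ∈ pre ++ k ∷ d ∷ t
    τ-in (inj₁ p)    = ∈-++⁺ˡ p
    τ-in (inj₂ refl) = ∈-mid pre
    tail : ∀ {l l'} → (∀ {z} → z ∈ l → z ∈ l') → k ⋕ l → Anti pre l' → τ ∈ pre ⊎ τ ≡ k → τ ⋕ l
    tail i f g (inj₁ p) q    = g p (i q)
    tail i f g (inj₂ refl) q = f q

  -- Let `k` be the first vertex touching a part beyond a corner. From `k` the path is turned into
  -- such a part, and the Z-path is chosen among the admissible ones so as to avoid it. Where the
  -- parts touched by `k` leave no admissible choice, two of them and the way back through `v` form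
  -- a spider at `k`. If there is no `k`, the path itself is compared with the original Z-path.
  cross : ∀ {v α β A B N K} {sL : Side v B A K} {sR : Side v A B N} → Cfg v α β sL sR →
          ∀ {qs} → NE qs → Leg v qs → (∀ {x} → x ∈ qs → Z x → x ∉ˡ v ∷ A × x ∉ˡ v ∷ B) → Crossing v α β sL sR qs
  cross {v} {A = A} {B} {sL = sL} {sR} cfg {qs} ne Q avoid
    with firstSat (λ x → ¬? (x ⋕? (bey sR ++ bey sL))) qs
  ... | inj₁ none = go qs Q ne (lastSat (λ z → ¬? (z ⋕? ((v ∷ A) ++ (v ∷ B)))) qs) avoid (λ p q → stable⋕ (none p) q)
    where
    go : ∀ qs → Leg v qs → NE qs → LastSat (λ z → ¬ (z ⋕ ((v ∷ A) ++ (v ∷ B)))) qs → (∀ {x} → x ∈ qs → Z x → x ∉ˡ v ∷ A × x ∉ˡ v ∷ B) → Anti qs (bey sR ++ bey sL) → Crossing v _ _ sL sR qs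
    go qs Q ne (inj₁ none) _ _ = ⊥-elim (starts qs Q ne none)
      where
      starts : ∀ qs → Leg v qs → NE qs → ¬ (∀ {z} → z ∈ qs → ¬ ¬ (z ⋕ ((v ∷ A) ++ (v ∷ B))))
      starts (q ∷ _) (step a _ _) _ none = none (here refl) λ f → #⇒≁ (f (here refl)) (~-sym a)
    go .(m ++ τ ∷ s) Q _ (inj₂ (m , τ , s , refl , th , far)) avoid fr =
      crossing m τ s refl (λ p q → fr (∈-++⁺ˡ p) (∈-++⁺ˡ q)) (λ p q → fr (∈-++⁺ˡ p) (∈-++⁺ʳ (bey sR) q))
        (classify cfg (ok₁ {y = own}) (hit s Lτ ωA ωB (proj₁ (τ∉ s Lτ ωA ωB)) (proj₂ (τ∉ s Lτ ωA ωB))) (λ _ → tt)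
          (λ q → fr (∈-mid m) (∈-++⁺ʳ (bey sR) (∈-++⁺ˡ (own-tail {s = sL} q)))) (λ q → fr (∈-mid m) (∈-++⁺ˡ (∈-++⁺ˡ (own-tail {s = sR} q))))
          (λ { (f , g) → th (λ q → both f g (∈-++⁻ (v ∷ A) q)) }))
      where
      both : ∀ {z} → τ ⋕ (v ∷ A) → τ ⋕ (v ∷ B) → z ∈ v ∷ A ⊎ z ∈ v ∷ B → τ # z
      both f g (inj₁ q) = f q
      both f g (inj₂ q) = g q
      Lτ : Leg τ s
      Lτ = leg-tail m Q
      ωA : Anti s (v ∷ A)
      ωA p q = stable⋕ (far p) (∈-++⁺ˡ q)
      ωB : Anti s (v ∷ B)
      ωB p q = stable⋕ (far p) (∈-++⁺ʳ (v ∷ A) q)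
      τ∉ : ∀ s → Leg τ s → Anti s (v ∷ A) → Anti s (v ∷ B) → (∀ {y} → y ∈ v ∷ A → τ ≢ y) × (∀ {y} → y ∈ v ∷ B → τ ≢ y)
      τ∉ (_ ∷ _) L f g = leg-∉path L f , leg-∉path L g
      -- With no successor to keep `τ` off the Z-path, `τ` is the end of the path and lies in `Z`;
      -- this is the case for which `avoid` is assumed.
      τ∉ [] (end z) f g = (λ { q refl → proj₁ (avoid (∈-mid m) z) q }) , (λ { q refl → proj₂ (avoid (∈-mid m) z) q })
  ... | inj₂ (pre , k , post , refl , far , tk) = main
    where
    open Cfg cfg
    fR : Anti pre (bey sR)
    fR p q = stable⋕ (far p) (∈-++⁺ˡ q)
    fL : Anti pre (bey sL)
    fL p q = stable⋕ (far p) (∈-++⁺ʳ (bey sR) q)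
    v-R₁ : v ⋕ bey₁ sR
    v-R₁ = vo-bey₁ D sR (here refl)
    v-R₂ : v ⋕ bey₂ sR
    v-R₂ = vo-bey₂ sR (here refl)
    v-L₁ : v ⋕ bey₁ sL
    v-L₁ = vo-bey₁ (swap D) sL (here refl)
    v-L₂ : v ⋕ bey₂ sL
    v-L₂ = vo-bey₂ sL (here refl)
    k∉ : ∀ {l} → v ⋕ l → Anti pre l → ∀ {y} → y ∈ l → k ≢ y
    k∉ f g q refl with leg-prev pre Q
    ... | _ , here refl , a = #⇒≁ (f q) a
    ... | _ , there p , a = #⇒≁ (g p q) a
    R₁ : Anti pre (bey₁ sR)
    R₁ p q = fR p (∈-++⁺ˡ q)
    R₂ : Anti pre (bey₂ sR)
    R₂ p q = fR p (∈-++⁺ʳ (bey₁ sR) q)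
    L₁ : Anti pre (bey₁ sL)
    L₁ p q = fL p (∈-++⁺ˡ q)
    L₂ : Anti pre (bey₂ sL)
    L₂ p q = fL p (∈-++⁺ʳ (bey₁ sL) q)
    hitR₁ : ¬ (k ⋕ bey₁ sR) → _
    hitR₁ = side-hit₁ D sR (k∉ v-R₁ R₁)
    hitR₂ : ¬ (k ⋕ bey₂ sR) → _
    hitR₂ = side-hit₂ sR (k∉ v-R₂ R₂)
    hitL₁ : ¬ (k ⋕ bey₁ sL) → _
    hitL₁ = side-hit₁ (swap D) sL (k∉ v-L₁ L₁)
    hitL₂ : ¬ (k ⋕ bey₂ sL) → _
    hitL₂ = side-hit₂ sL (k∉ v-L₂ L₂)
    -- Two legs leaving k beyond the corners, and a third one back through v.
    claw : ∀ {Y d t d' t' E E'} → Leg v Y → Leg k (d ∷ t) → (∀ {y} → y ∈ d ∷ t → y ∈ E) → Leg k (d' ∷ t') → (∀ {y} → y ∈ d' ∷ t' → y ∈ E') →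
           Anti E E' → Anti pre E → Anti pre E' → Anti (v ∷ Y) E → Anti (v ∷ Y) E' → ⊥
    claw {Y} LY L i L' i' EE' pE pE' YE YE' with carry pre Q LY
    ... | l , Lk , j = spider Lk L L' (λ p q → back pE YE (j p) (i q)) (λ p q → back pE' YE' (j p) (i' q)) (λ p q → EE' (i p) (i' q))
      where
      back : ∀ {E x y} → Anti pre E → Anti (v ∷ Y) E → x ∈ pre ⊎ x ∈ v ∷ Y → y ∈ E → x # y
      back f g (inj₁ p) q = f p q
      back f g (inj₂ p) q = g p q
    vp : ∀ {l m} → v ⋕ l → Anti pre l → (∀ {y} → y ∈ m → y ∈ l) → Anti (v ∷ pre) m
    vp f g i (here refl) q = f (i q)
    vp f g i (there p) q = g p (i q)
    plain : ∀ {d t E} → Leg k (d ∷ t) → (∀ {y} → y ∈ d ∷ t → y ∈ E) → v ⋕ E → Anti pre E → Anti (v ∷ A) E → Anti (v ∷ B) E →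
            k ⋕ bey₁ sR → k ⋕ bey₁ sL → Crossing v _ _ sL sR (pre ++ k ∷ post)
    plain L i vE pE AE BE kR kL = finish cfg (ok₁ {y = own}) pre Q fR fL L (vp vE pE i)
      (λ p q → #-sym (AE q (i p))) (λ p q → #-sym (BE q (i p)))
      (λ q → kL (own-tail {s = sL} q)) (λ q → kR (own-tail {s = sR} q))
      (λ q → ∈-++⁺ˡ (own-tail {s = sL} q)) (λ q → ∈-++⁺ˡ (own-tail {s = sR} q)) (λ _ → tt)
    main : Crossing v _ _ sL sR (pre ++ k ∷ post)
    main with k ⋕? bey₁ sR | k ⋕? bey₂ sR | k ⋕? bey₁ sL | k ⋕? bey₂ sL
    ... | no r₁ | no r₂ | _ | _ with hitR₁ r₁ | hitR₂ r₂
    ...   | _ , _ , L , i | _ , _ , L' , i' =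
      ⊥-elim (claw (legA D) L i L' i' (bey₁-bey₂ sR) R₁ R₂ (vo-bey₁ D sR) (vo-bey₂ sR))
    main | no r₁ | yes r₂ | no l₁ | _ with hitR₁ r₁ | hitL₁ l₁ | other-exit D sR r₁
    ...   | _ , _ , L , i | _ , _ , L' , i' | Y , y , f , _ =
      ⊥-elim (claw (legB DY) L i L' i' (λ p q → #-sym (anti D (bey₁-sub sL q) (bey₁-sub sR p))) R₁ L₁ f
        λ { (here refl) q → v-L₁ q ; (there p) q → #-sym (anti DY (bey₁-sub sL q) p) })
      where
      DY : DL v A Y
      DY = opt-dl D y
    main | no r₁ | yes r₂ | yes l₁ | _ with hitR₁ r₁ | other-exit D sR r₁
    ...   | _ , _ , L , i | Y , y , f , ty =
      finish cfg (ok₁ {y = y}) pre Q fR fL L (vp v-R₁ R₁ i) (λ p q → #-sym (vo-bey₁ D sR q (i p))) (λ p q → #-sym (f q (i p)))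
        (λ q → l₁ (own-tail {s = sL} q)) (λ q → r₂ (ty q)) (λ q → ∈-++⁺ˡ (own-tail {s = sL} q)) (λ q → ∈-++⁺ʳ (bey₁ sR) (ty q)) (λ _ → tt)
    main | yes r₁ | _ | no l₁ | no l₂ with hitL₁ l₁ | hitL₂ l₂
    ...   | _ , _ , L , i | _ , _ , L' , i' =
      ⊥-elim (claw (legB D) L i L' i' (bey₁-bey₂ sL) L₁ L₂ (vo-bey₁ (swap D) sL) (vo-bey₂ sL))
    main | yes r₁ | no r₂ | no l₁ | yes l₂ with hitL₁ l₁ | hitR₂ r₂
    ...   | _ , _ , L , i | _ , _ , L' , i' =
      ⊥-elim (claw (legB D) L i L' i' (λ p q → vo-bey₂ sR (there (bey₁-sub sL p)) q) L₁ R₂ (vo-bey₁ (swap D) sL) (vl-bey₂ sR))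
    main | yes r₁ | yes r₂ | no l₁ | yes l₂ with hitL₁ l₁ | other-exit (swap D) sL l₁
    ...   | d , t , L , i | X , x , f , tx =
      finish cfg (ok₂ {x = x}) pre Q fR fL L (vp v-L₁ L₁ i) (λ p q → #-sym (f q (i p))) (λ p q → #-sym (vo-bey₁ (swap D) sL q (i p)))
        (λ q → l₂ (tx q)) (λ q → r₁ (own-tail {s = sR} q)) (λ q → ∈-++⁺ʳ (bey₁ sL) (tx q)) (λ q → ∈-++⁺ˡ (own-tail {s = sR} q)) (ex x)
      where
      off : ∀ {z} → z ∈ pre ++ k ∷ d ∷ t → z ⋕ bey₂ sR
      off p q with ∈-++⁻ pre p
      ... | inj₁ r           = R₂ r q
      ... | inj₂ (here refl) = r₂ q
      ... | inj₂ (there r)   = vo-bey₂ sR (there (bey₁-sub sL (i r))) q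
      ex : ∀ {X} (x : Opt sL X) {z} → z ∈ pre ++ k ∷ d ∷ t → Extra sR x z
      ex own p = tt
      ex alt p = off p
    -- `k` may touch both attached legs. These can be adjacent, so no spider is claimed; the
    -- original Z-path avoids both.
    main | yes r₁ | no r₂ | yes l₁ | _ with hitR₂ r₂
    ...   | _ , _ , L , i = plain L i v-R₂ R₂ (vo-bey₂ sR) (vl-bey₂ sR) r₁ l₁
    main | yes r₁ | yes r₂ | yes l₁ | no l₂ with hitL₂ l₂
    ...   | _ , _ , L , i = plain L i v-L₂ L₂ (vl-bey₂ sL) (vo-bey₂ sL) r₁ l₁
    main | yes r₁ | yes r₂ | yes l₁ | yes l₂ = ⊥-elim (tk λ q → all4 (∈-++⁻ (bey sR) q))
      where
      all4 : ∀ {z} → z ∈ bey sR ⊎ z ∈ bey sL → k # z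
      all4 (inj₁ q) with ∈-++⁻ (bey₁ sR) q
      ... | inj₁ r = r₁ r
      ... | inj₂ r = r₂ r
      all4 (inj₂ q) with ∈-++⁻ (bey₁ sL) q
      ... | inj₁ r = l₁ r
      ... | inj₂ r = l₂ r

-- Complete adjacency between paths that cross at the same corner.

module Bipartite (G : Graph) (Z : V G → Set) (spider : Basics.Legs.Spiderless G Z) where

  open Crossings G Z spider public

  pair-tail : ∀ {x : V G} {l} l₁ {p p' l₂} → x ∷ l ≡ l₁ ++ p ∷ p' ∷ l₂ → p' ∈ l
  pair-tail [] refl           = here refl
  pair-tail (_ ∷ l₁) e = ∈-pair₂ l₁ (Listₚ.∷-injectiveʳ e)

  -- Here p is the first vertex of a path from v that touches the corner c.  If it were not adjacent to σ,
  -- then the leg of σ would attach wrongly to the path T, c, p, h, v, Y.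
  crossing-complete : ∀ {v X Y c T h p post σ} → Leg v Y →
    (∀ {z} → z ∈ c ∷ T → z ∈ X) → Leg c T → Anti (c ∷ T) (v ∷ Y) →
    Leg v (h ++ p ∷ post) → Anti h (c ∷ T) → p ~ c → p ⋕ T → (∀ {z} → z ∈ h → ¬ Z z) →
    (hσ : Hit v X Y σ) → σ ~ c → σ ⋕ T → σ ≢ p → (∀ {z} → z ∈ h → σ ≢ z) →
    (∀ {η} → η ∈ h → (hη : Hit v X Y η) → (∀ {z} → z ∈ Hit.ω hη → z ∈ h ⊎ z ∈ Hit.ω hσ) → ¬ (η ⋕ (v ∷ X) × η ⋕ (v ∷ Y)) → ⊥) →
    σ ~ p
  crossing-complete {v} {X} {Y} {c} {T} {h} {p} {post} {σ} LY cT Lc cvY Q h-cT p~c p-T hZ (hit ω Lσ ωX ωY σ∉X σ∉Y) σ~c σ-T σ≢p σ∉h closure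
    with carry h Q LY
  ... | l , Lp , l⊆ = conclude (attach Dc (inj₁ tt) Lσ ωcpl ωcT σ∉cpl σ∉cT λ { (f , _) → #⇒≁ (f (here refl)) σ~c })
    where
    -- Otherwise the path could leave `h` for the end of `ω`, and its last contact with the Z-path
    -- would be a vertex of `h`, against `closure`.
    ω-h : Anti ω h
    ω-h with lastSat (λ x → ¬? (x ⋕? h)) ω
    ... | inj₁ none = λ q r → stable⋕ (none q) r
    ... | inj₂ (m , x , s , eω , tx , far) with firstSat (λ y → ¬? (x #? y)) h
    ...   | inj₁ none = ⊥-elim (tx λ q → stable# (none q))
    ...   | inj₂ (h₁ , q , h₂ , eh , xh₁ , xq) = ⊥-elim contra
      where
      in-ω : ∀ {z} → z ∈ x ∷ s → z ∈ ω
      in-ω r = subst (_ ∈_) (≡-sym eω) (∈-++⁺ʳ m r)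
      in-h₁ : ∀ {z} → z ∈ h₁ → z ∈ h
      in-h₁ r = subst (_ ∈_) (≡-sym eh) (∈-++⁺ˡ r)
      q∈h : q ∈ h
      q∈h = subst (_ ∈_) (≡-sym eh) (∈-mid h₁)
      Lx : Leg x s
      Lx = leg-tail m (subst (Leg σ) eω Lσ)
      x∉h : ∀ {s} → Leg x s → Anti s h → x ∉ˡ h
      x∉h (end z) _ r = hZ r z
      x∉h (step a _ _) f r = #⇒≁ (f (here refl) r) (~-sym a)
      x~q : x ~ q
      x~q = ¬#⇒~ xq λ { refl → x∉h Lx (λ r r' → stable⋕ (far r) r') q∈h }
      Lq : Leg q (x ∷ s)
      Lq = step (~-sym x~q) (λ r → #-sym (stable⋕ (far r) q∈h)) Lx
      Q' : Leg v (h₁ ++ q ∷ h₂ ++ p ∷ post)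
      Q' = subst (Leg v) (trans (cong (_++ p ∷ post) eh) (Listₚ.++-assoc h₁ (q ∷ h₂) _)) Q
      vh₁ : Anti (v ∷ h₁) (x ∷ s)
      vh₁ (here refl) r          = #-sym (ωX (in-ω r) (here refl))
      vh₁ (there r) (here refl)  = #-sym (stable# (xh₁ r))
      vh₁ (there r) (there r')   = #-sym (stable⋕ (far r') (in-h₁ r))
      contra : ⊥
      contra with last-touch {X = X} {Y} h₁ Q' Lq vh₁ (λ r → ωX (in-ω r)) (λ r → ωY (in-ω r))
      ... | lastTouch _ τ _ _ _ τ∈ hits ω⊆ touch = closure (τ-in τ∈) hits out touch
        where
        τ-in : τ ∈ h₁ ⊎ τ ≡ q → τ ∈ h
        τ-in (inj₁ r)    = in-h₁ r
        τ-in (inj₂ refl) = q∈h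
        out : ∀ {z} → z ∈ Hit.ω hits → z ∈ h ⊎ z ∈ ω
        out r with ∈-++⁻ h₁ (ω⊆ r)
        ... | inj₁ r'           = inj₁ (in-h₁ r')
        ... | inj₂ (here refl)  = inj₁ q∈h
        ... | inj₂ (there r')   = inj₂ (in-ω r')

    c-l : c ⋕ l
    c-l r with l⊆ r
    ... | inj₁ r' = #-sym (h-cT r' (here refl))
    ... | inj₂ r' = cvY (here refl) r'
    Dc : DL c (p ∷ l) T
    Dc = dl (step (~-sym p~c) c-l Lp) Lc sep
      where
      sep : Anti (p ∷ l) T
      sep (here refl) r = p-T r
      sep (there q) r with l⊆ q
      ... | inj₁ q' = h-cT q' (there r)
      ... | inj₂ q' = #-sym (cvY (there r) q')
    ωcT : Anti ω (c ∷ T)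
    ωcT q r = ωX q (there (cT r))
    ω-l : Anti ω l
    ω-l q r with l⊆ r
    ... | inj₁ r' = ω-h q r'
    ... | inj₂ r' = ωY q r'
    -- Otherwise the last vertex of `ω` touching `p` would attach to the Z-path T, c, p, l in `p`
    -- alone.
    p-ω : p ⋕ ω
    p-ω with lastSat (λ x → ¬? (p #? x)) ω
    ... | inj₁ none = λ q → stable# (none q)
    ... | inj₂ (m , x , s , eω , px , far) = ⊥-elim (attach-single Dc (inj₁ tt) (leg-tail m (subst (Leg σ) eω Lσ))
        (λ { r (here refl) → ωcT (in-ω (there r)) (here refl) ; r (there (here refl)) → #-sym (stable# (far r)) ; r (there (there r')) → ω-l (in-ω (there r)) r' })
        (λ r → ωcT (in-ω (there r))) (inj₁ (there (here refl)))
        (~-sym (¬#⇒~ px λ { refl → #⇒≁ (ωcT (in-ω (here refl)) (here refl)) p~c }))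
        (λ { (here refl) _ → ωcT (in-ω (here refl)) (here refl) ; (there (here refl)) n → ⊥-elim (n refl) ; (there (there r')) _ → ω-l (in-ω (here refl)) r' })
        (λ r _ → ωcT (in-ω (here refl)) r))
      where
      in-ω : ∀ {z} → z ∈ x ∷ s → z ∈ ω
      in-ω r = subst (_ ∈_) (≡-sym eω) (∈-++⁺ʳ m r)
    ωcpl : Anti ω (c ∷ p ∷ l)
    ωcpl q (here refl)         = ωcT q (here refl)
    ωcpl q (there (here refl)) = #-sym (p-ω q)
    ωcpl q (there (there r))   = ω-l q r
    σ∉cpl : ∀ {y} → y ∈ c ∷ p ∷ l → σ ≢ y
    σ∉cpl (here refl) = ~⇒≢ σ~c
    σ∉cpl (there (here refl)) = σ≢p
    σ∉cpl (there (there r)) with l⊆ r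
    ... | inj₁ r' = σ∉h r'
    ... | inj₂ r' = σ∉Y r'
    σ∉cT : ∀ {y} → y ∈ c ∷ T → σ ≢ y
    σ∉cT r = σ∉X (there (cT r))
    conclude : (Σ ℕ (Split σ (c ∷ T)) × σ ⋕ (p ∷ l)) ⊎ (Σ ℕ (Split σ (c ∷ p ∷ l)) × σ ⋕ T) → σ ~ p
    conclude (inj₁ ((_ , split l₁ _ _ _ e _ _ _ a₂ _) , _)) = ⊥-elim (#⇒≁ (σ-T (pair-tail l₁ e)) a₂)
    conclude (inj₂ ((_ , split [] _ _ _ refl _ _ _ a₂ _) , _)) = a₂
    conclude (inj₂ ((_ , split (x ∷ l₁) _ _ _ e _ f₁ _ _ _) , _)) with Listₚ.∷-injectiveˡ e
    ... | refl = ⊥-elim (#⇒≁ (f₁ (here refl)) σ~c)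

  -- The way back from `q` through `v` makes `q` attach to the Z-path T, c, u, U at two consecutive
  -- vertices, and each alternative leaves only `c`, `u`. So `q` serves for crossings along either
  -- continuation.
  corner-first : ∀ {v o l₁ p c T u U h q post} → DL v o (l₁ ++ p ∷ c ∷ T) → Att v o l₁ p c T u U →
    Leg v (h ++ q ∷ post) → Anti h (c ∷ T) → Anti h (u ∷ U) → q ≢ c → q ≢ u → ¬ (q # c × q # u) →
    (q ⋕ T × q ⋕ U) ⊎ (q ~ c × q ⋕ T) ⊎ (q ~ u × q ⋕ U) → (q ~ c × q ⋕ T) × (q ~ u × q ⋕ U)
  corner-first {v} {o} {l₁} {p} {c} {T} {u} {U} {h} {q} D a Q hcT huU q≢c q≢u tq alts with carry h Q (legA D)
  ... | l , Lq , l⊆ = conclude alts (attach Dc (inj₁ tt) Lq lcuU lcT ∉cuU ∉cT λ { (f , _) → tq (f (here refl) , f (there (here refl))) })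
    where
    Dc : DL c (u ∷ U) T
    Dc = corner-dl D a
    lcT : Anti l (c ∷ T)
    lcT r r' with l⊆ r
    ... | inj₁ k = hcT k r'
    ... | inj₂ (here refl) = vl₁-cT D a (here refl) r'
    ... | inj₂ (there k) = anti D k (∈-++⁺ʳ l₁ (there r'))
    luU : Anti l (u ∷ U)
    luU r r' with l⊆ r
    luU r r' | inj₁ k = huU k r'
    luU r (here refl) | inj₂ (here refl) = #-sym (u-v a)
    luU r (there r') | inj₂ (here refl) = #-sym (U-l a r' (here refl))
    luU r (here refl) | inj₂ (there k) = #-sym (u-o a k)
    luU r (there r') | inj₂ (there k) = #-sym (U-o a r' k)
    lcuU : Anti l (c ∷ u ∷ U)
    lcuU r (here refl) = lcT r (here refl)
    lcuU r (there r')  = luU r r'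
    ∉U : (q ⋕ T × q ⋕ U) ⊎ (q ~ c × q ⋕ T) ⊎ (q ~ u × q ⋕ U) → ∀ {y} → y ∈ U → q ≢ y
    ∉U (inj₁ (_ , f)) r = proj₁ (f r)
    ∉U (inj₂ (inj₁ (b , _))) r refl = #⇒≁ (U-l a r (there (∈-++⁺ʳ l₁ (there (here refl))))) b
    ∉U (inj₂ (inj₂ (_ , f))) r = proj₁ (f r)
    ∉T : (q ⋕ T × q ⋕ U) ⊎ (q ~ c × q ⋕ T) ⊎ (q ~ u × q ⋕ U) → ∀ {y} → y ∈ T → q ≢ y
    ∉T (inj₁ (f , _)) r = proj₁ (f r)
    ∉T (inj₂ (inj₁ (_ , f))) r = proj₁ (f r)
    ∉T (inj₂ (inj₂ (b , _))) r refl = #⇒≁ (u-T a r) (~-sym b)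
    ∉cuU : ∀ {y} → y ∈ c ∷ u ∷ U → q ≢ y
    ∉cuU (here refl)         = q≢c
    ∉cuU (there (here refl)) = q≢u
    ∉cuU (there (there r))   = ∉U alts r
    ∉cT : ∀ {y} → y ∈ c ∷ T → q ≢ y
    ∉cT (here refl) = q≢c
    ∉cT (there r)   = ∉T alts r
    conclude : (q ⋕ T × q ⋕ U) ⊎ (q ~ c × q ⋕ T) ⊎ (q ~ u × q ⋕ U) →
               (Σ ℕ (Split q (c ∷ T)) × q ⋕ (u ∷ U)) ⊎ (Σ ℕ (Split q (c ∷ u ∷ U)) × q ⋕ T) → (q ~ c × q ⋕ T) × (q ~ u × q ⋕ U)
    conclude _ (inj₂ ((_ , split [] _ _ _ refl _ _ a₁ a₂ f₂) , f)) = (a₁ , f) , (a₂ , f₂)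
    conclude (inj₁ (f , _)) (inj₁ ((_ , split l₁ _ _ _ e _ _ _ a₂ _) , _)) = ⊥-elim (#⇒≁ (f (pair-tail l₁ e)) a₂)
    conclude (inj₂ (inj₁ (_ , f))) (inj₁ ((_ , split l₁ _ _ _ e _ _ _ a₂ _) , _)) = ⊥-elim (#⇒≁ (f (pair-tail l₁ e)) a₂)
    conclude (inj₂ (inj₂ (b , _))) (inj₁ (_ , g)) = ⊥-elim (#⇒≁ (g (here refl)) b)
    conclude (inj₁ (_ , f)) (inj₂ ((_ , split (_ ∷ l₁) _ _ _ e _ _ _ a₂ _) , _)) = ⊥-elim (#⇒≁ (f (pair-tail l₁ (Listₚ.∷-injectiveʳ e))) a₂)
    conclude (inj₂ (inj₁ (b , _))) (inj₂ ((_ , split (x ∷ l₁) _ _ _ e _ f₁ _ a₂ _) , _)) with Listₚ.∷-injectiveˡ e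
    ... | refl = ⊥-elim (#⇒≁ (f₁ (here refl)) b)
    conclude (inj₂ (inj₂ (_ , f))) (inj₂ ((_ , split (_ ∷ l₁) _ _ _ e _ _ _ a₂ _) , _)) = ⊥-elim (#⇒≁ (f (pair-tail l₁ (Listₚ.∷-injectiveʳ e))) a₂)

-- Inner vertices of Z-paths, existence of configurations, and members of a family at a corner.

module Families (G : Graph) (Z : V G → Set) (spider : Basics.Legs.Spiderless G Z) where

  open Bipartite G Z spider public

  shift-to : ∀ {v A} m {x s} → DL v A (m ++ x ∷ s) → Σ VL λ A' → NE A' × DL x A' s
  shift-to [] D      = _ , tt , shift D
  shift-to (b ∷ m) D = shift-to m (shift D)

  InX : V G → Set
  InX v = Σ VL λ A → Σ VL λ B → DL v A B × NE A × NE B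

  InX⇒¬Z : ∀ {v} → InX v → ¬ Z v
  InX⇒¬Z (_ ∷ _ , _ ∷ _ , D , _) z = spider (end z) (legA D) (legB D) (λ ()) (λ ()) (anti D)

  inner-InX : ∀ {v A} m {x y s} → DL v A (m ++ x ∷ y ∷ s) → InX x
  inner-InX m D with shift-to m D
  ... | A' , ne , D' = A' , _ , D' , ne , tt

  inX-or-Z : ∀ {v A B x} → DL v A B → x ∈ B → InX x ⊎ Z x
  inX-or-Z D p with ∈-split p
  ... | m , _ ∷ _ , refl = inj₁ (inner-InX m D)
  ... | m , [] , refl with leg-tail m (legB D)
  ...   | end z = inj₂ z

  lastL : VL → VL
  lastL []          = []
  lastL (x ∷ [])    = x ∷ []
  lastL (x ∷ y ∷ l) = lastL (y ∷ l)

  lastL-∈ : ∀ m {x : V G} → x ∈ lastL (m ++ x ∷ [])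
  lastL-∈ []          = here refl
  lastL-∈ (_ ∷ [])    = here refl
  lastL-∈ (_ ∷ y ∷ m) = lastL-∈ (y ∷ m)

  lastL-⊆ : ∀ l {x : V G} → x ∈ lastL l → x ∈ l
  lastL-⊆ (x ∷ []) p    = p
  lastL-⊆ (x ∷ y ∷ l) p = there (lastL-⊆ (y ∷ l) p)

  lastL-length : ∀ l → length (lastL l) ≤ 1
  lastL-length []          = z≤n
  lastL-length (x ∷ [])    = s≤s z≤n
  lastL-length (x ∷ y ∷ l) = lastL-length (y ∷ l)

  Z-last : ∀ {v A B x} → DL v A B → x ∈ B → Z x → x ∈ lastL B
  Z-last D p z with ∈-split p
  ... | m , _ ∷ _ , refl = ⊥-elim (InX⇒¬Z (inner-InX m D) z)
  ... | m , [] , refl = lastL-∈ m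

  Class : V G → V G → V G → Set
  Class v α β = Σ VL λ A → Σ VL λ B → DL v A B × First α A × First β B

  side-of : ∀ {v o l} N → HasSide v o l N → Side v o l N
  side-of nothing _ = triv
  side-of (just n) (l₁ , p , c , T , u , U , refl , refl , a) = real l₁ p c T u U a

  record Config (v α β : V G) : Set where
    constructor config
    field
      {A B} : VL
      {N K} : Maybe ℕ
      sL    : Side v B A K
      sR    : Side v A B N
      cfg   : Cfg v α β sL sR

  make-config : ∀ {v α β} → Class v α β → ¬ ¬ Config v α β
  make-config {v} {α} {β} cls = ¬¬-min RightAt >>= right
    where
    RightAt : ℕ → Set
    RightAt n = Σ VL λ A → Σ VL λ B → DL v A B × First α A × First β B × HasAtt v A B n
    LeftAt : Maybe ℕ → ℕ → Set
    LeftAt N k = Σ VL λ A → Σ VL λ B → DL v A B × First α A × First β B × HasSide v A B N × HasAtt v B A k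
    with-N : ∀ N → (∀ {A' B' n} → n <∞ N → DL v A' B' → First α A' → First β B' → HasAtt v A' B' n → ⊥) →
             (Σ VL λ A → Σ VL λ B → DL v A B × First α A × First β B × HasSide v A B N) → ¬ ¬ Config v α β
    with-N N mR (A , B , D , f , g , s) = ¬¬-min (LeftAt N) >>= λ where
      (inj₁ none) → return (config triv (side-of N s) (record
        { D = D ; fA = f ; fB = g ; minR = mR ; minL = λ {_} {_} {k} _ D' f' g' s' h' → none k (_ , _ , D' , f' , g' , s' , h') }))
      (inj₂ (k , (A , B , D , f , g , s , h) , least)) → return (config (side-of (just k) h) (side-of N s) (record
        { D = D ; fA = f ; fB = g ; minR = mR ; minL = λ {_} {_} {k'} lt D' f' g' s' h' → least k' lt (_ , _ , D' , f' , g' , s' , h') }))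
    right : ((∀ n → ¬ RightAt n) ⊎ (Σ ℕ λ n → RightAt n × (∀ m → m < n → ¬ RightAt m))) → ¬ ¬ Config v α β
    right (inj₁ none) = with-N nothing (λ {_} {_} {n} _ D' f' g' h' → none n (_ , _ , D' , f' , g' , h'))
      (proj₁ cls , proj₁ (proj₂ cls) , proj₁ (proj₂ (proj₂ cls)) , proj₁ (proj₂ (proj₂ (proj₂ cls))) , proj₂ (proj₂ (proj₂ (proj₂ cls))) , tt)
    right (inj₂ (n , w , least)) = with-N (just n) (λ {_} {_} {m} lt D' f' g' h' → least m lt (_ , _ , D' , f' , g' , h')) w

  ¬¬-firstSat : (D : V G → Set) → ∀ l → ¬ ¬ FirstSat D l
  ¬¬-firstSat D [] = return (inj₁ λ ())
  ¬¬-firstSat D (a ∷ l) = em {D a} >>= λ where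
    (inj₁ d)  → return (inj₂ ([] , a , l , refl , (λ ()) , d))
    (inj₂ nd) → ¬¬-firstSat D l >>= λ where
      (inj₁ none) → return (inj₁ λ { (here refl) → nd ; (there p) → none p })
      (inj₂ (m , x , s , refl , r , d)) → return (inj₂ (a ∷ m , x , s , refl , (λ { (here refl) → nd ; (there p) → r p }) , d))

  tail⊆bey : ∀ {v o l N} {s : Side v o l N} {Y} (y : Opt s Y) → ∀ {z} → z ∈ tailOf y → z ∈ bey s
  tail⊆bey {s = s} own q = ∈-++⁺ˡ (own-tail {s = s} q)
  tail⊆bey (alt {T = T}) q = ∈-++⁺ʳ T q

  Full : ∀ {v o l N} → Side v o l N → V G → Set
  Full triv p = ⊥
  Full (real _ _ c T u U _) p = (p ~ c × p ⋕ T) × (p ~ u × p ⋕ U)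

  HFar : ∀ {v o l N} → Side v o l N → VL → Set
  HFar triv h = ⊤
  HFar (real _ _ c T u U _) h = Anti h (c ∷ T) × Anti h (u ∷ U)

  record Head {v o l N} (s : Side v o l N) (pre : VL) (σ : V G) (post : VL) : Set where
    constructor head
    field
      h     : VL
      p     : V G
      post' : VL
      eq    : pre ++ σ ∷ post ≡ h ++ p ∷ post'
      h⊆    : ∀ {z} → z ∈ h → z ∈ pre
      far   : HFar s h
      full  : Full s p

  -- The head is the first vertex of the path that touches `c` or `u`; this is `σ` if no vertex of
  -- `pre` does.
  head-vertex : ∀ {v o l N} (s : Side v o l N) → DL v o l → ∀ pre {σ post} → Leg v (pre ++ σ ∷ post) → Anti pre (bey s) →
    (∀ {x} → x ∈ pre ++ σ ∷ post → x ∉ˡ corners s) → ∀ {Y} (y : Opt s Y) → CornerHit y σ → Head s pre σ post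
  head-vertex triv D pre Q far av own ()
  head-vertex {v} {o} s@(real l₁ b c T u U a) D pre {σ} {post} Q far av y ch with firstSat (λ x → ¬? (x ⋕? (c ∷ u ∷ []))) pre
  ... | inj₁ none = head pre σ post refl id (hcT , huU)
      (corner-first D a Q hcT huU (≢c (∈-mid pre)) (≢u (∈-mid pre)) (touch y ch) (alts y ch))
    where
    hcT : Anti pre (c ∷ T)
    hcT q (here refl) = stable⋕ (none q) (here refl)
    hcT q (there r)   = far q (∈-++⁺ˡ r)
    huU : Anti pre (u ∷ U)
    huU q (here refl) = stable⋕ (none q) (there (here refl))
    huU q (there r)   = far q (∈-++⁺ʳ T r)
    ≢c : ∀ {x} → x ∈ pre ++ σ ∷ post → x ≢ c
    ≢c q refl = av q (here refl)
    ≢u : ∀ {x} → x ∈ pre ++ σ ∷ post → x ≢ u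
    ≢u q refl = av q (there (here refl))
    touch : ∀ {Y} (y : Opt s Y) → CornerHit y σ → ¬ (σ # c × σ # u)
    touch own (_ , b , _) (f , _) = #⇒≁ f b
    touch alt (_ , b , _) (_ , f) = #⇒≁ f b
    alts : ∀ {Y} (y : Opt s Y) → CornerHit y σ → (σ ⋕ T × σ ⋕ U) ⊎ (σ ~ c × σ ⋕ T) ⊎ (σ ~ u × σ ⋕ U)
    alts own (_ , b , f) = inj₂ (inj₁ (b , f))
    alts alt (_ , b , f) = inj₂ (inj₂ (b , f))
  ... | inj₂ (m , x , t , refl , none , tx) = head m x (t ++ σ ∷ post) (Listₚ.++-assoc m (x ∷ t) _) ∈-++⁺ˡ (hcT , huU)
      (corner-first D a (subst (Leg v) (Listₚ.++-assoc m (x ∷ t) _) Q) hcT huU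
        (λ { refl → av (∈-++⁺ˡ (∈-mid m)) (here refl) }) (λ { refl → av (∈-++⁺ˡ (∈-mid m)) (there (here refl)) })
        (λ { (f , g) → tx λ { (here refl) → f ; (there (here refl)) → g } })
        (inj₁ ((λ r → far (∈-mid m) (∈-++⁺ˡ r)) , (λ r → far (∈-mid m) (∈-++⁺ʳ T r)))))
    where
    hcT : Anti m (c ∷ T)
    hcT q (here refl) = stable⋕ (none q) (here refl)
    hcT q (there r)   = far (∈-++⁺ˡ q) (∈-++⁺ˡ r)
    huU : Anti m (u ∷ U)
    huU q (here refl) = stable⋕ (none q) (there (here refl))
    huU q (there r)   = far (∈-++⁺ˡ q) (∈-++⁺ʳ T r)

  corner-complete : ∀ {v m₁ b c T Y h p post σ} → DL v (m₁ ++ b ∷ c ∷ T) Y →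
    Leg v (h ++ p ∷ post) → Anti h (c ∷ T) → p ~ c → p ⋕ T → (∀ {z} → z ∈ h → ¬ Z z) →
    (hσ : Hit v (m₁ ++ b ∷ c ∷ T) Y σ) → σ ~ c → σ ⋕ T → σ ≢ p → (∀ {z} → z ∈ h → σ ≢ z) →
    (∀ {η} → η ∈ h → (hη : Hit v (m₁ ++ b ∷ c ∷ T) Y η) → (∀ {z} → z ∈ Hit.ω hη → z ∈ h ⊎ z ∈ Hit.ω hσ) →
       ¬ (η ⋕ (v ∷ m₁ ++ b ∷ c ∷ T) × η ⋕ (v ∷ Y)) → ⊥) →
    σ ~ p
  corner-complete {v} {m₁} {b} {c} {T} {Y} D Q = crossing-complete (legB D) in-X Lc sep Q
    where
    in-X : ∀ {z} → z ∈ c ∷ T → z ∈ m₁ ++ b ∷ c ∷ T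
    in-X q = ∈-++⁺ʳ m₁ (there q)
    Lc : Leg c T
    Lc with leg-tail m₁ (legA D)
    ... | step _ _ k = k
    sep : Anti (c ∷ T) (v ∷ Y)
    sep q (here refl) = #-sym (leg-sep m₁ (legA D) (here refl) q)
    sep q (there r)   = anti D (in-X q) r

  hit-swap : ∀ {v X Y σ} → Hit v X Y σ → Hit v Y X σ
  hit-swap (hit ω L a b c d) = hit ω L b a d c

  Int : VL → Set
  Int qs = ∀ m {x y s} → qs ≡ m ++ x ∷ y ∷ s → ¬ Z x

  int-pre : ∀ {qs} → Int qs → ∀ h {p post} → qs ≡ h ++ p ∷ post → ∀ {z} → z ∈ h → ¬ Z z
  int-pre int h e q with ∈-split q
  ... | m , [] , refl    = int m (trans e (Listₚ.++-assoc m _ _))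
  ... | m , _ ∷ _ , refl = int m (trans e (Listₚ.++-assoc m _ _))

  -- Paths from v whose last vertex is their only vertex in Z.
  record Mem (v : V G) : Set where
    constructor mem
    field
      qs  : VL
      leg : Leg v qs
      int : Int qs
  open Mem using (qs)

  Disj : ∀ {v} → Mem v → Mem v → Set
  Disj m m' = ∀ {x} → x ∈ qs m → x ∉ˡ qs m'

  module _ {v A B N K} (α β : V G) (sL : Side v B A K) (sR : Side v A B N) where

    -- `noEv` makes `σ` the earliest possible crossing on the path, which is what completeness at a
    -- corner needs.
    record Item (m : Mem v) : Set where
      field
        pre post : VL
        σ        : V G
        eq       : qs m ≡ pre ++ σ ∷ post
        farR     : Anti pre (bey sR)
        farL     : Anti pre (bey sL)
        noEv     : ∀ {z} → z ∈ pre → ¬ Ev v α β sL sR z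
        {X Y}    : VL
        {x}      : Opt sL X
        {y}      : Opt sR Y
        ok       : Ok x y
        hits     : Hit v X Y σ
        ex       : ∀ {z} → z ∈ σ ∷ Hit.ω hits → Extra sR x z

    LItem RItem : Mem v → Set
    LItem m = Σ (Item m) λ i → CornerHit (Item.x i) (Item.σ i) × Head sL (Item.pre i) (Item.σ i) (Item.post i)
    RItem m = Σ (Item m) λ i → CornerHit (Item.y i) (Item.σ i) × Head sR (Item.pre i) (Item.σ i) (Item.post i)

  -- First vertices x of paths that leave v at the corner formed by v, β and x, or by v, α and x.
  Good : ∀ v → V G → V G → Mem v → Set
  Good v α β m = Σ (V G) λ x → Σ VL λ l → qs m ≡ x ∷ l ×
    ((Class v α x × x ~ β × x # α) ⊎ (Class v β x × x ~ α × x # β))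

  extra-far : ∀ {v A B N K} {sL : Side v B A K} (sR : Side v A B N) {X} (x : Opt sL X) {z} → z ⋕ bey sR → Extra sR x z
  extra-far sR own f = tt
  extra-far sR alt f = λ q → f (∈-++⁺ʳ (bey₁ sR) q)

  side-complete : ∀ {v o l N} (s : Side v o l N) {X Y h p post σ} (x : Opt s X) → DL v X Y →
    Leg v (h ++ p ∷ post) → HFar s h → Full s p → (∀ {z} → z ∈ h → ¬ Z z) →
    (hσ : Hit v X Y σ) → CornerHit x σ → σ ≢ p → (∀ {z} → z ∈ h → σ ≢ z) →
    (∀ {η} → η ∈ h → (hη : Hit v X Y η) → (∀ {z} → z ∈ Hit.ω hη → z ∈ h ⊎ z ∈ Hit.ω hσ) → ¬ (η ⋕ (v ∷ X) × η ⋕ (v ∷ Y)) → ⊥) →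
    σ ~ p
  side-complete (real m₁ _ _ _ _ _ _) own D Q (f , _) ((a , b) , _) hZ hσ (_ , c , d) = corner-complete {m₁ = m₁} D Q f a b hZ hσ c d
  side-complete (real m₁ _ _ _ _ _ _) alt D Q (_ , f) (_ , (a , b)) hZ hσ (_ , c , d) = corner-complete {m₁ = m₁} D Q f a b hZ hσ c d

  module _ {v α β A B N K} {sL : Side v B A K} {sR : Side v A B N} (cfg : Cfg v α β sL sR) {m m' : Mem v} (dis : Disj m m')
           (i : Item α β sL sR m) (j : Item α β sL sR m') where

    private
      module I = Item i
      module J = Item j

    -- A path that starts along `m` and ends along the leg of the other item would cross at `η`,
    -- before the earliest crossing on `m`.
    item-closure : ∀ {h} → (∀ {z} → z ∈ h → z ∈ I.pre) → ∀ {η} → η ∈ h → (hη : Hit v J.X J.Y η) →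
                   (∀ {z} → z ∈ Hit.ω hη → z ∈ h ⊎ z ∈ Hit.ω J.hits) → ¬ (η ⋕ (v ∷ J.X) × η ⋕ (v ∷ J.Y)) → ⊥
    item-closure {h} h⊆ {η} q hη out touch = I.noEv (h⊆ q)
      (classify cfg J.ok hη ex' (λ r → I.farL (h⊆ q) (tail⊆bey J.x r)) (λ r → I.farR (h⊆ q) (tail⊆bey J.y r)) touch)
      where
      ex' : ∀ {z} → z ∈ η ∷ Hit.ω hη → Extra sR J.x z
      ex' (here refl) = extra-far sR J.x (I.farR (h⊆ q))
      ex' (there r) with out r
      ... | inj₁ r' = extra-far sR J.x (I.farR (h⊆ r'))
      ... | inj₂ r' = J.ex (there r')

    module _ {o l M} {s : Side v o l M} (hd : Head s I.pre I.σ I.post) where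

      open Head hd using (h; p; post')

      head-eq : qs m ≡ h ++ p ∷ post'
      head-eq = trans I.eq (Head.eq hd)

      head-leg : Leg v (h ++ p ∷ post')
      head-leg = subst (Leg v) head-eq (Mem.leg m)

      head-int : ∀ {z} → z ∈ h → ¬ Z z
      head-int = int-pre (Mem.int m) h head-eq

      head-≢ : ∀ {z} → z ∈ h ++ p ∷ post' → J.σ ≢ z
      head-≢ q refl = dis (subst (_ ∈_) (≡-sym head-eq) q) (subst (J.σ ∈_) (≡-sym J.eq) (∈-mid J.pre))

    L-complete : (hd : Head sL I.pre I.σ I.post) → CornerHit J.x J.σ → J.σ ~ Head.p hd
    L-complete hd ch = side-complete sL J.x (ok-dl (Cfg.D cfg) J.ok) (head-leg hd) (Head.far hd) (Head.full hd) (head-int hd) J.hits ch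
      (head-≢ hd (∈-mid (Head.h hd))) (λ q → head-≢ hd (∈-++⁺ˡ q)) (item-closure (Head.h⊆ hd))

    R-complete : (hd : Head sR I.pre I.σ I.post) → CornerHit J.y J.σ → J.σ ~ Head.p hd
    R-complete hd ch = side-complete sR J.y (swap (ok-dl (Cfg.D cfg) J.ok)) (head-leg hd) (Head.far hd) (Head.full hd) (head-int hd) (hit-swap J.hits) ch
      (head-≢ hd (∈-mid (Head.h hd))) (λ q → head-≢ hd (∈-++⁺ˡ q))
      (λ q hη out touch → item-closure (Head.h⊆ hd) q (hit-swap hη) out λ { (f , g) → touch (g , f) })

  length-++-≤ : ∀ (l : VL) {l' a b} → length l ≤ a → length l' ≤ b → length (l ++ l') ≤ a + b
  length-++-≤ l p q = ℕₚ.≤-trans (ℕₚ.≤-reflexive (Listₚ.length-++ l)) (ℕₚ.+-mono-≤ p q)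

  -- At most two corner vertices on each side and the two ends of the Z-path, its only vertices in
  -- `Z`: 2 + 2 + 1 + 1 = 6.
  exceptions : ∀ {v α β} → Config v α β → VL
  exceptions (config {A} {B} sL sR _) = corners sL ++ corners sR ++ lastL A ++ lastL B

  exceptions-length : ∀ {v α β} (c : Config v α β) → length (exceptions c) ≤ 6
  exceptions-length (config {A} {B} sL sR _) = length-++-≤ (corners sL) (two sL) (length-++-≤ (corners sR) (two sR) (length-++-≤ (lastL A) (lastL-length A) (lastL-length B)))
    where
    two : ∀ {v o l N} (s : Side v o l N) → length (corners s) ≤ 2
    two triv = z≤n
    two (real _ _ _ _ _ _ _) = ℕₚ.≤-refl

  leg-first : ∀ {v} pre {σ post} → Leg v (pre ++ σ ∷ post) → v ~ σ → pre ≡ []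
  leg-first [] _ _ = refl
  leg-first (_ ∷ pre) (step _ f _) a = ⊥-elim (#⇒≁ (f (∈-mid pre)) a)

  cfg-cross : ∀ {v α β} (c : Config v α β) {qs} → Leg v qs → (∀ {x} → x ∈ qs → x ∉ˡ exceptions c) →
              Crossing v α β (Config.sL c) (Config.sR c) qs
  cfg-cross {v} (config {A} {B} sL sR cfg) {qs} L av = cross cfg (ne L) L avoid
    where
    open Cfg cfg
    ne : ∀ {qs} → Leg v qs → NE qs
    ne (end z) = InX⇒¬Z (_ , _ , D , first-NE fA , first-NE fB) z
    ne (step _ _ _) = tt
    avoid : ∀ {x} → x ∈ qs → Z x → x ∉ˡ v ∷ A × x ∉ˡ v ∷ B
    avoid q z = (λ { (here refl) → leg-∉ L q refl
                   ; (there r) → av q (∈-++⁺ʳ (corners sL) (∈-++⁺ʳ (corners sR) (∈-++⁺ˡ (Z-last (swap D) r z)))) })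
              , (λ { (here refl) → leg-∉ L q refl
                   ; (there r) → av q (∈-++⁺ʳ (corners sL) (∈-++⁺ʳ (corners sR) (∈-++⁺ʳ (lastL A) (Z-last D r z)))) })

  item : ∀ {v α β} (c : Config v α β) (m : Mem v) → (∀ {x} → x ∈ qs m → x ∉ˡ exceptions c) →
         ¬ ¬ (LItem α β (Config.sL c) (Config.sR c) m ⊎ RItem α β (Config.sL c) (Config.sR c) m ⊎ Good v α β m)
  item {v} {α} {β} c@(config sL sR cfg) m av with cfg-cross c (Mem.leg m) av
  -- The crossing found need not be the earliest; an earlier one inherits the two distance
  -- conditions.
  ... | crossing pre σ post eq farR farL ev = ¬¬-firstSat (Ev v α β sL sR) pre >>= λ where
      (inj₁ none) → return (kind pre eq farR farL none ev)
      (inj₂ (p , x , s , e , none , ev')) → return (kind p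
        (trans eq (trans (cong (_++ σ ∷ post) e) (Listₚ.++-assoc p (x ∷ s) _)))
        (λ q → farR (subst (_ ∈_) (≡-sym e) (∈-++⁺ˡ q))) (λ q → farL (subst (_ ∈_) (≡-sym e) (∈-++⁺ˡ q))) none ev')
    where
    kind : ∀ pre {σ post} → qs m ≡ pre ++ σ ∷ post → Anti pre (bey sR) → Anti pre (bey sL) →
           (∀ {z} → z ∈ pre → ¬ Ev v α β sL sR z) → Ev v α β sL sR σ →
           LItem α β sL sR m ⊎ RItem α β sL sR m ⊎ Good v α β m
    kind pre {σ} {post} eq farR farL none ev with ev
    ... | evL ok hits ex ch _ _ _ = inj₁ (record { pre = pre ; post = post ; σ = σ ; eq = eq ; farR = farR ; farL = farL ; noEv = none ; ok = ok ; hits = hits ; ex = ex }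
          , ch , head-vertex sL (swap (Cfg.D cfg)) pre (subst (Leg v) eq (Mem.leg m)) farL (λ q r → av (subst (_ ∈_) (≡-sym eq) q) (∈-++⁺ˡ r)) _ ch)
    ... | evR ok hits ex ch _ _ _ = inj₂ (inj₁ (record { pre = pre ; post = post ; σ = σ ; eq = eq ; farR = farR ; farL = farL ; noEv = none ; ok = ok ; hits = hits ; ex = ex }
          , ch , head-vertex sR (Cfg.D cfg) pre (subst (Leg v) eq (Mem.leg m)) farR (λ q r → av (subst (_ ∈_) (≡-sym eq) q) (∈-++⁺ʳ (corners sL) (∈-++⁺ˡ r))) _ ch))
    ... | ev+ f D a b = inj₂ (inj₂ (σ , post , first D , inj₁ ((_ , _ , D , f , _ , refl) , a , b)))
      where
      first : ∀ {X ω} → DL v X (σ ∷ ω) → qs m ≡ σ ∷ post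
      first (dl _ (step e _ _) _) = trans eq (cong (_++ σ ∷ post) (leg-first pre (subst (Leg v) eq (Mem.leg m)) e))
    ... | ev- f D a b = inj₂ (inj₂ (σ , post , first D , inj₂ ((_ , _ , swap D , f , _ , refl) , a , b)))
      where
      first : ∀ {Y ω} → DL v (σ ∷ ω) Y → qs m ≡ σ ∷ post
      first (dl (step e _ _) _ _) = trans eq (cong (_++ σ ∷ post) (leg-first pre (subst (Leg v) eq (Mem.leg m)) e))

-- Counting paths from a vertex on a Z-path.

module Counting (G : Graph) (Z : V G → Set) (spider : Basics.Legs.Spiderless G Z) (w t : ℕ)
  (clique≤w : ∀ cs → AllPairs (Basics._~_ G) cs → length cs ≤ w)
  (no-Ktt : ∀ as bs → length as ≡ t → length bs ≡ t → AllPairs (Basics._#_ G) as → AllPairs (Basics._#_ G) bs →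
            (∀ {a b} → a ∈ as → b ∈ bs → Basics._~_ G a b) → ⊥) where

  open Families G Z spider public
  open Mem using (qs)

  Fam : V G → Set
  Fam v = List (Mem v)

  avoid-one : ∀ {v} x (fam : Fam v) → AllPairs Disj fam →
    Σ (Fam v) λ good → good ⊆ fam × length fam ≤ 1 + length good × All (λ m → x ∉ˡ qs m) good
  avoid-one x [] _ = [] , [] , z≤n , []
  avoid-one x (m ∷ fam) (d ∷ ds) with DecMembership._∈?_ _≟_ x (qs m)
  ... | yes p = fam , m ∷ʳ ⊆-refl , ℕₚ.≤-refl , All.map (λ f → f p) d
  ... | no np with avoid-one x fam ds
  ...   | good , s , l , a = m ∷ good , refl ∷ s , s≤s l , np ∷ a

  avoid-all : ∀ {v} F (fam : Fam v) → AllPairs Disj fam →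
    Σ (Fam v) λ good → good ⊆ fam × length fam ≤ length F + length good × All (λ m → ∀ x → x ∈ qs m → x ∉ˡ F) good
  avoid-all [] fam ds = fam , ⊆-refl , ℕₚ.≤-refl , All.universal (λ _ _ _ ()) fam
  avoid-all (x ∷ F) fam ds with avoid-one x fam ds
  ... | fam' , s , l , a with avoid-all F fam' (AllPairs-⊆ s ds)
  ...   | good , s' , l' , a' = good , ⊆-trans s' s , ℕₚ.≤-trans l (s≤s l') , All.zipWith (λ { (f , g) y p → λ { (here refl) → f p ; (there r) → g y p r } }) (All-resp-⊆ s' a , a')

  harvest : ∀ {v} {P : Mem v → Set} (f : ∀ {m} → P m → V G) → (∀ {m} (i : P m) → f i ∈ qs m) →
    ∀ {fam} → All P fam → AllPairs Disj fam →
    Σ VL λ ps → length ps ≡ length fam × AllPairs _≢_ ps × (∀ {a} → a ∈ ps → Σ (Mem v) λ m → m ∈ fam × Σ (P m) λ i → f i ≡ a)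
  harvest f f∈ [] [] = [] , refl , [] , λ ()
  harvest {v} {P} f f∈ {m ∷ fam} (i ∷ is) (d ∷ ds) with harvest {P = P} f f∈ is ds
  ... | ps , l , dis , from = f i ∷ ps , cong suc l , All.tabulate ne ∷ dis , from'
    where
    ne : ∀ {a} → a ∈ ps → f i ≢ a
    ne p refl with from p
    ... | m' , q , j , e = All.lookup d q (f∈ i) (subst (_∈ qs m') e (f∈ j))
    from' : ∀ {a} → a ∈ f i ∷ ps → _
    from' (here refl) = m , here refl , i , refl
    from' (there p) with from p
    ... | m' , q , r = m' , there q , r

  Rb : ℕ
  Rb = ramsey-bound (suc w) t

  stable-subset : ∀ xs → AllPairs _≢_ xs → Rb ≤ length xs → Σ VL λ ys → ys ⊆ xs × length ys ≡ t × AllPairs _#_ ys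
  stable-subset xs dis big with ramsey _~?_ (suc w) t xs big
  ... | inj₁ (ys , s , l , c) = ⊥-elim (ℕₚ.<⇒≱ (ℕₚ.≤-reflexive (≡-sym l)) (clique≤w ys c))
  ... | inj₂ (ys , s , l , c) = ys , s , l , pairs (AllPairs-⊆ s dis) c
    where
    pairs : ∀ {ys} → AllPairs _≢_ ys → AllPairs (λ x y → ¬ x ~ y) ys → AllPairs _#_ ys
    pairs [] [] = []
    pairs (n ∷ ns) (a ∷ as) = All.zipWith (λ { (f , g) → stable# λ h → g (¬#⇒~ h f) }) (n , a) ∷ pairs ns as

  cross-pairs : ∀ {v} (us : Fam v) {ws} → AllPairs Disj (us ++ ws) →
    AllPairs Disj us × AllPairs Disj ws × (∀ {m m'} → m ∈ us → m' ∈ ws → Disj m m')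
  cross-pairs [] ds = [] , ds , λ ()
  cross-pairs (u ∷ us) (d ∷ ds) with cross-pairs us ds
  ... | a , b , c = All.tabulate (λ p → All.lookup d (∈-++⁺ˡ p)) ∷ a , b ,
        λ { (here refl) q → All.lookup d (∈-++⁺ʳ us q) ; (there p) q → c p q }

  ⊆⇒∈ : ∀ {A : Set} {xs ys : List A} → xs ⊆ ys → ∀ {x} → x ∈ xs → x ∈ ys
  ⊆⇒∈ s p = All.lookup (All-resp-⊆ s (All.tabulate id)) p

  -- Adjacency is known only between disjoint members, so `f` is evaluated on one half of the family
  -- and `g` on the other. Each half contains a stable set of size `t`, as cliques are too small,
  -- and the two sets form an induced `K_{t,t}`.
  few-items : ∀ {v} {P : Mem v → Set} (f g : ∀ {m} → P m → V G) → (∀ {m} (i : P m) → f i ∈ qs m) → (∀ {m} (i : P m) → g i ∈ qs m) →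
    (∀ {m m'} → Disj m m' → (i : P m) (j : P m') → g j ~ f i) →
    ∀ fam → All P fam → AllPairs Disj fam → length fam ≤ Rb + Rb
  few-items {v} {P} f g f∈ g∈ complete fam is ds = ℕₚ.≮⇒≥ (too-many ∘ ℕₚ.<⇒≤)
    where
    too-many : ¬ (Rb + Rb ≤ length fam)
    too-many big with split-at Rb fam (ℕₚ.≤-trans (ℕₚ.m≤m+n Rb Rb) big)
    ... | us , ws , refl , lu with cross-pairs us ds | All-resp-⊆ (++⊆ˡ us) is | All-resp-⊆ (++⊆ʳ us) is
      where
      ++⊆ˡ : ∀ (us : Fam v) {ws} → us ⊆ us ++ ws
      ++⊆ˡ [] {[]} = []
      ++⊆ˡ [] {w ∷ ws} = w ∷ʳ ++⊆ˡ []
      ++⊆ˡ (u ∷ us) = refl ∷ ++⊆ˡ us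
      ++⊆ʳ : ∀ (us : Fam v) {ws} → ws ⊆ us ++ ws
      ++⊆ʳ [] = ⊆-refl
      ++⊆ʳ (u ∷ us) = u ∷ʳ ++⊆ʳ us
    ...   | du , dw , cross | iu | iw with harvest {P = P} f f∈ iu du | harvest {P = P} g g∈ iw dw
    ...     | ps , lp , pd , pfrom | σs , lσ , σd , σfrom
      with stable-subset ps pd (ℕₚ.≤-reflexive (≡-sym (trans lp lu)))
         | stable-subset σs σd (subst (Rb ≤_) (≡-sym lσ) (ℕₚ.+-cancelˡ-≤ Rb _ _ (ℕₚ.≤-trans big (ℕₚ.≤-reflexive (trans (Listₚ.length-++ us) (cong (_+ length ws) lu))))))
    ...       | as , sa , la , pa | bs , sb , lb , pb = no-Ktt as bs la lb pa pb adj-ab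
      where
      adj-ab : ∀ {a b} → a ∈ as → b ∈ bs → a ~ b
      adj-ab p q with pfrom (⊆⇒∈ sa p) | σfrom (⊆⇒∈ sb q)
      ... | m , m∈ , i , refl | m' , m'∈ , j , refl = ~-sym (complete (cross m∈ m'∈) i j)

  -- Each of the six exceptional vertices spoils at most one path, and at most `Rb + Rb` paths cross
  -- at each of the two corners.
  K₀ : ℕ
  K₀ = 6 + ((Rb + Rb) + (Rb + Rb))

  near : ∀ {v α β} → Class v α β → ∀ fam → AllPairs Disj fam →
         ¬ ¬ (Σ (Fam v) λ good → good ⊆ fam × length fam ≤ K₀ + length good × All (Good v α β) good)
  near {v} {α} {β} cls fam ds = make-config cls >>= at-config
    where
    at-config : Config v α β → ¬ ¬ (Σ (Fam v) λ good → good ⊆ fam × length fam ≤ K₀ + length good × All (Good v α β) good)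
    at-config c@(config sL sR cfg) with avoid-all (exceptions c) fam ds
    ... | fam₁ , s₁ , l₁ , av = ¬¬-All (All.map (λ {m} f → item c m (f _)) av) >>= count
      where
      count : All _ fam₁ → _
      count items with partition-⊎ items
      ... | Ls , rest , sL' , sr , aL , ar , e₁ with partition-⊎ ar
      ...   | Rs , good , sR' , sg , aR , ag , e₂ = return (good , ⊆-trans sg (⊆-trans sr s₁) , bound , ag)
        where
        ds₁ : AllPairs Disj fam₁
        ds₁ = AllPairs-⊆ s₁ ds
        p∈ : ∀ {o l M} {s : Side v o l M} {m : Mem v} (i : Item α β sL sR m) (hd : Head s (Item.pre i) (Item.σ i) (Item.post i)) → Head.p hd ∈ qs m
        p∈ i hd = subst (_ ∈_) (≡-sym (trans (Item.eq i) (Head.eq hd))) (∈-mid (Head.h hd))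
        σ∈ : ∀ {m} (i : Item α β sL sR m) → Item.σ i ∈ qs m
        σ∈ i = subst (_ ∈_) (≡-sym (Item.eq i)) (∈-mid (Item.pre i))
        fewL : length Ls ≤ Rb + Rb
        fewL = few-items {P = LItem α β sL sR} (λ { (i , _ , hd) → Head.p hd }) (λ { (i , _) → Item.σ i }) (λ { (i , _ , hd) → p∈ i hd }) (λ { (i , _) → σ∈ i })
          (λ { d (i , _ , hd) (j , ch , _) → L-complete cfg d i j hd ch }) Ls aL (AllPairs-⊆ sL' ds₁)
        fewR : length Rs ≤ Rb + Rb
        fewR = few-items {P = RItem α β sL sR} (λ { (i , _ , hd) → Head.p hd }) (λ { (i , _) → Item.σ i }) (λ { (i , _ , hd) → p∈ i hd }) (λ { (i , _) → σ∈ i })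
          (λ { d (i , _ , hd) (j , ch , _) → R-complete cfg d i j hd ch }) Rs aR (AllPairs-⊆ (⊆-trans sR' sr) ds₁)
        bound : length fam ≤ K₀ + length good
        bound = begin
          length fam                                                 ≤⟨ l₁ ⟩
          length (exceptions c) + length fam₁                        ≤⟨ ℕₚ.+-monoˡ-≤ _ (exceptions-length c) ⟩
          6 + length fam₁                                            ≡⟨ cong (6 +_) (trans e₁ (cong (length Ls +_) e₂)) ⟩
          6 + (length Ls + (length Rs + length good))                ≡⟨ cong (6 +_) (≡-sym (ℕₚ.+-assoc (length Ls) _ _)) ⟩
          6 + ((length Ls + length Rs) + length good)                ≤⟨ ℕₚ.+-monoʳ-≤ 6 (ℕₚ.+-monoˡ-≤ _ (ℕₚ.+-mono-≤ fewL fewR)) ⟩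
          6 + (((Rb + Rb) + (Rb + Rb)) + length good)                ≡⟨⟩
          K₀ + length good ∎
          where open ℕₚ.≤-Reasoning

  Plus : ∀ v → V G → Mem v → Set
  Plus v α m = Σ (V G) λ x → Σ VL λ l → qs m ≡ x ∷ l × Class v α x × x # α

  FirstOf : ∀ {v} → Fam v → V G → Set
  FirstOf {v} fam c = Σ (Mem v) λ m → m ∈ fam × Σ VL λ l → qs m ≡ c ∷ l

  -- Applying near to the neighbours α and x₀ of v shows that almost all other first vertices are adjacent to x₀.
  hub-clique : ∀ {v α} s fam → AllPairs Disj fam → All (Plus v α) fam → s * K₀ < length fam →
    ¬ ¬ (Σ VL λ cs → length cs ≡ suc s × AllPairs _~_ cs × All (FirstOf fam) cs)
  hub-clique s [] _ _ ()
  hub-clique zero (m ∷ fam) _ ((x , l , e , _) ∷ _) _ = return (x ∷ [] , refl , [] ∷ [] , (m , here refl , l , e) ∷ [])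
  hub-clique {v} {α} (suc s) fam@(m₀ ∷ _) ds ps@((x₀ , l₀ , e₀ , cls , _) ∷ _) big = near cls fam ds >>= λ where
      (good , sub , le , gs) → hub-clique s good (AllPairs-⊆ sub ds) (All-resp-⊆ sub ps)
          (ℕₚ.+-cancelˡ-< K₀ _ _ (ℕₚ.<-≤-trans big le)) >>= λ where
        (cs , len , cl , from) → return (x₀ ∷ cs , cong suc len , All.map (adj-x₀ sub gs) from ∷ cl ,
          (m₀ , here refl , l₀ , e₀) ∷ All.map (λ { (m , q , r) → m , ⊆⇒∈ sub q , r }) from)
    where
    first-≡ : ∀ {m : Mem v} {x y l l'} → qs m ≡ x ∷ l → qs m ≡ y ∷ l' → x ≡ y
    first-≡ e e' = Listₚ.∷-injectiveˡ (trans (≡-sym e) e')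
    adj-x₀ : ∀ {good} → good ⊆ fam → All (Good v α x₀) good → ∀ {c} → FirstOf good c → x₀ ~ c
    adj-x₀ sub gs (m , q , l , e) with All.lookup gs q | All.lookup ps (⊆⇒∈ sub q)
    ... | y , _ , e' , inj₁ (_ , a , _) | _ with first-≡ {m} e e'
    ...   | refl = ~-sym a
    -- The other way of leaving `v` at the pair `α`, `x₀` starts at a neighbour of `α`, which `Plus`
    -- excludes.
    adj-x₀ sub gs (m , q , l , e) | y , _ , e' , inj₂ (_ , a , _) | z , _ , e'' , _ , f with first-≡ {m} e' e''
    ...   | refl = ⊥-elim (#⇒≁ f a)

  hub-bound : ∀ {v α} fam → AllPairs Disj fam → All (Plus v α) fam → length fam ≤ w * K₀
  hub-bound fam ds ps = ℕₚ.≮⇒≥ λ big → hub-clique w fam ds ps big λ where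
    (cs , len , cl , _) → ℕₚ.<⇒≱ (ℕₚ.≤-reflexive (≡-sym len)) (clique≤w cs cl)

  -- `K₀` paths not crossing at `v`, and at most `w * K₀` for each of the two neighbours of `v` on
  -- the Z-path.
  N₂ : ℕ
  N₂ = K₀ + (w * K₀ + w * K₀)

  bound-on-path : ∀ {v} → InX v → ∀ fam → AllPairs Disj fam → length fam ≤ N₂
  bound-on-path {v} (α ∷ A , β ∷ B , D , _) fam ds = ℕₚ.≮⇒≥ λ big →
    near (_ , _ , D , (_ , refl) , (_ , refl)) fam ds λ where
      (good , sub , le , gs) → contra big sub le (partition-⊎ (All.map (λ {m} → side {m}) gs))
    where
    side : ∀ {m} → Good v α β m → Plus v α m ⊎ Plus v β m
    side (x , l , e , inj₁ (c , _ , f)) = inj₁ (x , l , e , c , f)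
    side (x , l , e , inj₂ (c , _ , f)) = inj₂ (x , l , e , c , f)
    contra : ∀ {good} → N₂ < length fam → good ⊆ fam → length fam ≤ K₀ + length good →
      (Σ (Fam v) λ ys → Σ (Fam v) λ zs → ys ⊆ good × zs ⊆ good × All (Plus v α) ys × All (Plus v β) zs × length good ≡ length ys + length zs) → ⊥
    contra big sub le (ys , zs , sy , sz , py , pz , e) = ℕₚ.<⇒≱ big (ℕₚ.≤-trans le (ℕₚ.+-monoʳ-≤ K₀ (ℕₚ.≤-trans (ℕₚ.≤-reflexive e)
      (ℕₚ.+-mono-≤ (hub-bound ys (AllPairs-⊆ (⊆-trans sy sub) ds) py) (hub-bound zs (AllPairs-⊆ (⊆-trans sz sub) ds) pz)))))

-- Vertices on no Z-path, and the bound for all vertices outside Z.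

module Bound (G : Graph) (Z : V G → Set) (spider : Basics.Legs.Spiderless G Z) (w t : ℕ)
  (clique≤w : ∀ cs → AllPairs (Basics._~_ G) cs → length cs ≤ w)
  (no-Ktt : ∀ as bs → length as ≡ t → length bs ≡ t → AllPairs (Basics._#_ G) as → AllPairs (Basics._#_ G) bs →
            (∀ {a b} → a ∈ as → b ∈ bs → Basics._~_ G a b) → ⊥)
  (stableZ : ∀ {x y} → Z x → Z y → ¬ Basics._~_ G x y) where

  open Counting G Z spider w t clique≤w no-Ktt public
  open Mem using (qs)

  -- Let `q` be the last vertex of the first path touching the second one or `v`, and `d` its last
  -- neighbour there. The two remainders joined by the edge from `q` to `d` form a Z-path. As `Z` is
  -- stable, `q` or `d` is an inner vertex of it.
  two-paths : ∀ {v} → ¬ Z v → ¬ InX v → (m₁ m₂ : Mem v) → Disj m₁ m₂ → Σ (V G) λ y → InX y × (y ∈ qs m₁ ⊎ y ∈ qs m₂)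
  two-paths {v} nZ nX m₁ m₂ dis with lastSat (λ x → ¬? (x ⋕? (v ∷ qs m₂))) (qs m₁)
  ... | inj₁ none = ⊥-elim (starts (Mem.leg m₁) (λ q → none q))
    where
    starts : ∀ {l} → Leg v l → ¬ (∀ {x} → x ∈ l → ¬ ¬ (x ⋕ (v ∷ qs m₂)))
    starts (end z) _ = nZ z
    starts (step a _ _) h = h (here refl) λ f → #⇒≁ (f (here refl)) (~-sym a)
  ... | inj₂ (m , q , s , e , tq , far) with lastSat (λ x → ¬? (q #? x)) (v ∷ qs m₂)
  ...   | inj₁ none = ⊥-elim (tq λ p → stable# (none p))
  ...   | inj₂ (m' , d , s' , e' , td , far') = result s s' (leg-tail m L₁) Ld (λ p r → stable⋕ (far p) (subst (_ ∈_) (≡-sym e') (∈-++⁺ʳ m' r))) (λ p → stable# (far' p))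
    where
    L₁ : Leg v (m ++ q ∷ s)
    L₁ = subst (Leg v) e (Mem.leg m₁)
    Ld : Leg d s'
    Ld = leg-cut (Mem.leg m₂) m' e'
    q∈ : q ∈ qs m₁
    q∈ = subst (_ ∈_) (≡-sym e) (∈-mid m)
    d∈ : d ∈ v ∷ qs m₂
    d∈ = subst (_ ∈_) (≡-sym e') (∈-mid m')
    q≢ : ∀ {y} → y ∈ v ∷ qs m₂ → q ≢ y
    q≢ (here refl) refl = leg-∉ (Mem.leg m₁) q∈ refl
    q≢ (there p) refl = dis q∈ p
    q~d : q ~ d
    q~d = ¬#⇒~ td (q≢ d∈)
    result : ∀ s s' → Leg q s → Leg d s' → Anti s (d ∷ s') → q ⋕ s' → Σ (V G) λ y → InX y × (y ∈ qs m₁ ⊎ y ∈ qs m₂)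
    result (x ∷ s) s' Lq Ld a f = q , (_ , _ , dl Lq (step q~d f Ld) a , tt , tt) , inj₁ q∈
    result [] [] (end z) (end z') a f = ⊥-elim (stableZ z z' q~d)
    result [] (x ∷ s') Lq Ld a f = d , X , inj₂ (other d∈)
      where
      X : InX d
      X = _ , _ , shift (dl Lq (step q~d f Ld) a) , tt , tt
      other : d ∈ v ∷ qs m₂ → d ∈ qs m₂
      other (here refl) = ⊥-elim (nX X)
      other (there p)   = p

  split-X : ∀ {v X Y σ ω n} → DL v X Y → Split σ Y n → Leg σ ω → Anti ω (v ∷ X) → Anti ω (v ∷ Y) → σ # v → σ ⋕ X → InX σ ⊎ Z σ
  split-X D (split l₁ p p' l₂ refl le f₁ a₁ a₂ f₂) L aX aY tv tX =
    inX-or-Z (alt-dl D (att L f₁ a₁ a₂ f₂ tv tX aY (λ q r → aX q (there r)))) (∈-++⁺ʳ l₁ (there (here refl)))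

  ev-X : ∀ {v α β} (c : Config v α β) {σ} → Ev v α β (Config.sL c) (Config.sR c) σ → InX σ ⊎ Z σ
  ev-X (config sL sR cfg) (evR ok (hit ω L a b _ _) _ _ f g (_ , sp)) = split-X (ok-dl (Cfg.D cfg) ok) sp L a b f g
  ev-X (config sL sR cfg) (evL ok (hit ω L a b _ _) _ _ f g (_ , sp)) = split-X (swap (ok-dl (Cfg.D cfg) ok)) sp L b a f g
  ev-X c (ev+ _ D _ _) = inX-or-Z D (here refl)
  ev-X c (ev- _ D _ _) = inX-or-Z (swap D) (here refl)

  side-X : ∀ {v o l N} → DL v o l → (s : Side v o l N) → ∀ {x} → x ∈ corners s → InX x ⊎ Z x
  side-X D (real l₁ _ _ _ _ _ a) (here refl) = inX-or-Z D (∈-++⁺ʳ l₁ (there (here refl)))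
  side-X D (real l₁ _ _ _ _ _ a) (there (here refl)) = inX-or-Z (alt-dl D a) (∈-++⁺ʳ l₁ (there (here refl)))

  exceptions-X : ∀ {v α β} (c : Config v α β) {x} → x ∈ exceptions c → InX x ⊎ Z x
  exceptions-X (config {A} {B} sL sR cfg) p with ∈-++⁻ (corners sL) p
  ... | inj₁ q = side-X (swap (Cfg.D cfg)) sL q
  ... | inj₂ q with ∈-++⁻ (corners sR) q
  ...   | inj₁ r = side-X (Cfg.D cfg) sR r
  ...   | inj₂ r with ∈-++⁻ (lastL A) r
  ...     | inj₁ k = inX-or-Z (swap (Cfg.D cfg)) (lastL-⊆ A k)
  ...     | inj₂ k = inX-or-Z (Cfg.D cfg) (lastL-⊆ B k)

  -- `p` is chosen rather than `c` or `u`: crossings at the corner are adjacent to `p` along either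
  -- continuation, and `p` is always an inner vertex of a Z-path, so the bound for such vertices
  -- applies to it.
  gate : ∀ {v o l N} → Side v o l N → VL
  gate triv = []
  gate (real _ p _ _ _ _ _) = p ∷ []

  gate-hit : ∀ {v o l N} {s : Side v o l N} {Y σ} (y : Opt s Y) → CornerHit y σ → Σ (V G) λ p → p ∈ gate s × σ ~ p
  gate-hit {s = real _ _ _ _ _ _ _} own (a , _) = _ , here refl , a
  gate-hit alt (a , _) = _ , here refl , a

  gate-length : ∀ {v o l N} (s : Side v o l N) → length (gate s) ≤ 1
  gate-length triv = z≤n
  gate-length (real _ _ _ _ _ _ _) = ℕₚ.≤-refl

  Touches : ∀ {v} → V G → Mem v → Set
  Touches p m = p ∉ˡ qs m × ¬ (p ⋕ qs m)

  -- Each path is cut at its last neighbour of `p`, and `p` becomes the new start; being subpaths,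
  -- the results stay disjoint.
  rebase : ∀ {v} p (fam : Fam v) → All (Touches p) fam → AllPairs Disj fam →
    Σ (Fam p) λ fam' → length fam' ≡ length fam × AllPairs Disj fam' × All (λ m' → Σ (Mem v) λ m → m ∈ fam × (∀ x → x ∈ qs m' → x ∈ qs m)) fam'
  rebase p [] [] [] = [] , refl , [] , []
  rebase p (m ∷ fam) ((p∉ , tp) ∷ ts) (d ∷ ds) with rebase p fam ts ds | lastSat (λ x → ¬? (p #? x)) (qs m)
  ... | _ | inj₁ none = ⊥-elim (tp λ q → stable# (none q))
  ... | fam' , l , ds' , from | inj₂ (pre , x , s , e , tx , far) =
    mem (x ∷ s) L int' ∷ fam' , cong suc l , All.map (λ {m'} → disj {m'}) from ∷ ds' , (m , here refl , λ _ → sub) ∷ All.map (λ { (m' , q , r) → m' , there q , r }) from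
    where
    sub : ∀ {y} → y ∈ x ∷ s → y ∈ qs m
    sub q = subst (_ ∈_) (≡-sym e) (∈-++⁺ʳ pre q)
    L : Leg p (x ∷ s)
    L = step (¬#⇒~ tx λ { refl → p∉ (sub (here refl)) }) (λ q → stable# (far q)) (leg-tail pre (subst (Leg _) e (Mem.leg m)))
    int' : Int (x ∷ s)
    int' k eq = Mem.int m (pre ++ k) (trans e (trans (cong (pre ++_) eq) (≡-sym (Listₚ.++-assoc pre k _))))
    disj : ∀ {m'} → (Σ (Mem _) λ m₂ → m₂ ∈ fam × (∀ y → y ∈ qs m' → y ∈ qs m₂)) → Disj (mem (x ∷ s) L int') m'
    disj (m₂ , q , r) y∈ y∈' = All.lookup d q (sub y∈) (r _ y∈')

  touch-bound : ∀ {v p} → InX p → (fam : Fam v) → All (Touches p) fam → AllPairs Disj fam → length fam ≤ N₂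
  touch-bound {p = p} X fam ts ds with rebase p fam ts ds
  ... | fam' , l , ds' , _ = subst (_≤ N₂) l (bound-on-path X fam' ds')

  gate-bound : ∀ {v u o l N} (s : Side u o l N) → DL u o l → (fam : Fam v) →
    All (λ m → Σ (V G) λ p → p ∈ gate s × Touches p m) fam → AllPairs Disj fam → length fam ≤ N₂
  gate-bound triv D [] _ _ = z≤n
  gate-bound triv D (_ ∷ _) ((_ , () , _) ∷ _) _
  gate-bound (real l₁ _ _ _ _ _ _) D fam ts ds = touch-bound (inner-InX l₁ D) fam (All.map (λ { (_ , here refl , r) → r }) ts) ds

  -- Nine vertices to avoid, namely `y`, six exceptions and two gates, and then at most `N₂` paths
  -- touching each of `y` and the two gates.
  N₃ : ℕ
  N₃ = 9 + (N₂ + (N₂ + N₂))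

  bound-off-path : ∀ {v} → ¬ Z v → ¬ InX v → (fam : Fam v) → AllPairs Disj fam → (m₀ : Mem v) → ∀ {y} → y ∈ qs m₀ → InX y →
                   ¬ (N₃ < length fam)
  bound-off-path {v} nZ nX fam ds m₀ {y₀} y₀∈ y₀X big = ¬¬-firstSat InX (qs m₀) λ where
      (inj₁ none) → none y₀∈ y₀X
      (inj₂ (M , y , post , e , noX , (α ∷ A , β ∷ B , D , _))) →
        make-config (_ , _ , D , (_ , refl) , (_ , refl)) (at-y M y post e noX (_ , _ , D , tt , tt))
    where
    at-y : ∀ M y post → qs m₀ ≡ M ++ y ∷ post → (∀ {x} → x ∈ M → ¬ InX x) → InX y → ∀ {α β} → ¬ Config y α β
    at-y M y post e noX yX {α} {β} c@(config sL sR cfg) = conclude (avoid-all F fam ds)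
      where
      F : VL
      F = y ∷ exceptions c ++ gate sL ++ gate sR
      F-length : length F ≤ 9
      F-length = s≤s (length-++-≤ (exceptions c) (exceptions-length c) (length-++-≤ (gate sL) (gate-length sL) (gate-length sR)))
      off : ∀ {x} → x ∈ M ⊎ x ≡ v → InX x ⊎ Z x → ⊥
      off (inj₁ p) (inj₁ X) = noX p X
      off (inj₁ p) (inj₂ z) = int-pre (Mem.int m₀) M e p z
      off (inj₂ refl) (inj₁ X) = nX X
      off (inj₂ refl) (inj₂ z) = nZ z
      touched : ∀ {m : Mem v} → (∀ x → x ∈ qs m → x ∉ˡ F) →
        Touches y m ⊎ (Σ (V G) λ p → p ∈ gate sL × Touches p m) ⊎ (Σ (V G) λ p → p ∈ gate sR × Touches p m)
      -- The path from `y` goes back along `M` to `v` and out along `m`. Its crossing vertex is in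
      -- `Z` or inside a Z-path, unlike `v` and the vertices of `M`, so it lies on `m`.
      touched {m} av with carry M (subst (Leg v) e (Mem.leg m₀)) (Mem.leg m)
      ... | l , Ly , l⊆ with cfg-cross c Ly avoid
        where
        avoid : ∀ {x} → x ∈ l → x ∉ˡ exceptions c
        avoid p q with l⊆ p
        ... | inj₁ r           = off (inj₁ r) (exceptions-X c q)
        ... | inj₂ (here refl) = off (inj₂ refl) (exceptions-X c q)
        ... | inj₂ (there r)   = av _ r (there (∈-++⁺ˡ q))
      ...   | crossing pre σ post' e' _ _ ev = by ev
        where
        σ∈ : σ ∈ qs m
        σ∈ with l⊆ (subst (σ ∈_) (≡-sym e') (∈-mid pre))
        ... | inj₁ r           = ⊥-elim (off (inj₁ r) (ev-X c ev))
        ... | inj₂ (here refl) = ⊥-elim (off (inj₂ refl) (ev-X c ev))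
        ... | inj₂ (there r)   = r
        touches : ∀ {p} → p ∈ F → σ ~ p → Touches p m
        touches p∈ a = (λ q → av _ q p∈) , λ f → #⇒≁ (f σ∈) (~-sym a)
        y~ : ∀ {X ω} → DL y X (σ ∷ ω) → σ ~ y
        y~ (dl _ (step a _ _) _) = ~-sym a
        by : Ev y α β sL sR σ → Touches y m ⊎ (Σ (V G) λ p → p ∈ gate sL × Touches p m) ⊎ (Σ (V G) λ p → p ∈ gate sR × Touches p m)
        by (ev+ _ D _ _) = inj₁ (touches (here refl) (y~ D))
        by (ev- _ D _ _) = inj₁ (touches (here refl) (y~ (swap D)))
        by (evL _ _ _ ch _ _ _) with gate-hit _ ch
        ... | p , q , a = inj₂ (inj₁ (p , q , touches (there (∈-++⁺ʳ (exceptions c) (∈-++⁺ˡ q))) a))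
        by (evR _ _ _ ch _ _ _) with gate-hit _ ch
        ... | p , q , a = inj₂ (inj₂ (p , q , touches (there (∈-++⁺ʳ (exceptions c) (∈-++⁺ʳ (gate sL) q))) a))
      conclude : (Σ (Fam v) λ good → good ⊆ fam × length fam ≤ length F + length good × All (λ m → ∀ x → x ∈ qs m → x ∉ˡ F) good) → ⊥
      conclude (good , s , le , av) with partition-⊎ (All.map (λ {m} → touched {m}) av)
      ... | ys , rest , s₁ , s₂ , t₁ , t₂ , e₁ with partition-⊎ t₂
      ...   | ls , rs , s₃ , s₄ , t₃ , t₄ , e₂ = ℕₚ.<⇒≱ big (begin
          length fam                                      ≤⟨ le ⟩
          length F + length good                          ≤⟨ ℕₚ.+-monoˡ-≤ _ F-length ⟩
          9 + length good                                 ≡⟨ cong (9 +_) (trans e₁ (cong (length ys +_) e₂)) ⟩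
          9 + (length ys + (length ls + length rs))       ≤⟨ ℕₚ.+-monoʳ-≤ 9 (ℕₚ.+-mono-≤ (touch-bound yX ys t₁ (AllPairs-⊆ (⊆-trans s₁ s) ds))
                                                               (ℕₚ.+-mono-≤ (gate-bound sL (swap (Cfg.D cfg)) ls t₃ (AllPairs-⊆ (⊆-trans s₃ (⊆-trans s₂ s)) ds))
                                                                            (gate-bound sR (Cfg.D cfg) rs t₄ (AllPairs-⊆ (⊆-trans s₄ (⊆-trans s₂ s)) ds)))) ⟩
          N₃ ∎)
        where open ℕₚ.≤-Reasoning

  path-bound : ∀ {v} → ¬ Z v → (fam : Fam v) → AllPairs Disj fam → length fam ≤ N₃
  path-bound {v} nZ fam ds = ℕₚ.≮⇒≥ λ big → em {InX v} λ where
      (inj₁ X)  → ℕₚ.<⇒≱ big (ℕₚ.≤-trans (bound-on-path X fam ds) (ℕₚ.≤-trans (ℕₚ.m≤m+n N₂ _) (ℕₚ.m≤n+m _ 9)))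
      (inj₂ nX) → off-path fam ds nX big
    where
    off-path : ∀ fam → AllPairs Disj fam → ¬ InX v → ¬ (N₃ < length fam)
    off-path (m₁ ∷ m₂ ∷ fam) ds@((d ∷ _) ∷ _) nX big with two-paths nZ nX m₁ m₂ d
    ... | y , X , inj₁ p = bound-off-path nZ nX (m₁ ∷ m₂ ∷ fam) ds m₁ p X big
    ... | y , X , inj₂ p = bound-off-path nZ nX (m₁ ∷ m₂ ∷ fam) ds m₂ p X big
    off-path [] _ _ ()
    off-path (_ ∷ []) _ _ (s≤s ())

-- Passing between lists and indexed families.

lookup-pairs : {A : Set} {R : A → A → Set} → (∀ {x y} → R x y → R y x) → ∀ {xs} → AllPairs R xs →
               ∀ i j → i ≢ j → R (lookup xs i) (lookup xs j)
lookup-pairs s (p ∷ ps) Fin.zero Fin.zero n = ⊥-elim (n refl)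
lookup-pairs s (p ∷ ps) Fin.zero (Fin.suc j) n = All.lookup p (∈-lookup j)
lookup-pairs s (p ∷ ps) (Fin.suc i) Fin.zero n = s (All.lookup p (∈-lookup i))
lookup-pairs s (p ∷ ps) (Fin.suc i) (Fin.suc j) n = lookup-pairs s ps i j (n ∘ cong Fin.suc)

module _ (G : Graph) where

  open Basics G

  pairs-injective : {R : V G → V G → Set} → (∀ {x y} → R x y → R y x) → (∀ {x y} → R x y → x ≢ y) → ∀ {xs} → AllPairs R xs →
                    Injective _≡_ _≡_ (lookup xs)
  pairs-injective s r {xs} ps {i} {j} e with i Finₚ.≟ j
  ... | yes q = q
  ... | no n  = ⊥-elim (r (lookup-pairs s ps i j n) e)

  clique-list : ∀ {w} → IsCliqueNumber G w → ∀ cs → AllPairs _~_ cs → length cs ≤ w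
  clique-list (_ , max) cs ps = max (length cs) (lookup cs) (pairs-injective ~-sym ~⇒≢ ps , lookup-pairs ~-sym ps)

  stable-fun : ∀ {t} xs → length xs ≡ t → AllPairs _#_ xs →
    Σ (Fin t → V G) λ f → Injective _≡_ _≡_ f × (∀ i j → NonAdj G (f i) (f j)) × (∀ i → f i ∈ xs)
  stable-fun xs refl ps = lookup xs , pairs-injective #-sym proj₁ ps , nonadj , ∈-lookup
    where
    nonadj : ∀ i j → NonAdj G (lookup xs i) (lookup xs j)
    nonadj i j with i Finₚ.≟ j
    ... | yes refl = irr G (lookup xs i)
    ... | no n     = proj₂ (lookup-pairs #-sym ps i j n)

  Ktt-list : ∀ {t} → KttFree G t → ∀ as bs → length as ≡ t → length bs ≡ t → AllPairs _#_ as → AllPairs _#_ bs →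
             (∀ {a b} → a ∈ as → b ∈ bs → a ~ b) → ⊥
  Ktt-list free as bs la lb pa pb complete with stable-fun as la pa | stable-fun bs lb pb
  ... | f , fi , fn , f∈ | g , gi , gn , g∈ =
    free (f , g , fi , gi , (λ i j → ~⇒≢ (complete (f∈ i) (g∈ j))) , fn , gn , λ i j → complete (f∈ i) (g∈ j))

  module _ (Z : VSet G) {k : ℕ} {p : Fin (suc k) → V G} (path : IsInducedPath G k p) (start : p Fin.zero Sub.∈ Z) where

    open Legs (Sub._∈ Z)

    Below : ℕ → V G → Set
    Below j x = Σ (Fin (suc k)) λ i → toℕ i < j × p i ≡ x

    -- The part of the path from its j-th vertex down to the first vertex in Z.
    record Down (j : ℕ) (x : V G) : Set where
      field
        l     : List (V G)
        leg   : Leg x l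
        int   : ∀ m {a b s} → l ≡ m ++ a ∷ b ∷ s → ¬ a Sub.∈ Z
        below : ∀ {y} → y ∈ l → Below j y

    next : ∀ j (h : suc j < suc k) → p (fromℕ< h) ~ p (fromℕ< (ℕₚ.<-trans (ℕₚ.n<1+n j) h))
    next j h = proj₂ (proj₂ path) _ _ (inj₂ (trans (cong suc (Finₚ.toℕ-fromℕ< (ℕₚ.<-trans (ℕₚ.n<1+n j) h))) (≡-sym (Finₚ.toℕ-fromℕ< h))))

    down : ∀ j → (j<k : j < suc k) → Down j (p (fromℕ< j<k))
    down zero (s≤s _) = record { l = [] ; leg = end start ; int = λ { [] () ; (_ ∷ _) () } ; below = λ () }
    down (suc j) sj<k with down j (ℕₚ.<-trans (ℕₚ.n<1+n j) sj<k) | p (fromℕ< (ℕₚ.<-trans (ℕₚ.n<1+n j) sj<k)) Subₚ.∈? Z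
    ... | _ | yes z = record
      { l = _ ∷ [] ; leg = step (next j sj<k) (λ ()) (end z) ; int = λ { [] () ; (_ ∷ []) () ; (_ ∷ _ ∷ _) () }
      ; below = λ { (here refl) → _ , s≤s (ℕₚ.≤-reflexive (Finₚ.toℕ-fromℕ< _)) , refl } }
    ... | d | no nz = record
      { l = _ ∷ Down.l d ; leg = step (next j sj<k) far (Down.leg d) ; int = int'
      ; below = λ { (here refl) → _ , s≤s (ℕₚ.≤-reflexive (Finₚ.toℕ-fromℕ< _)) , refl
                  ; (there q) → weaken (Down.below d q) } }
      where
      weaken : ∀ {y} → Below j y → Below (suc j) y
      weaken (i , lt , e) = i , ℕₚ.m<n⇒m<1+n lt , e
      int' : ∀ m {a b s} → _ ∷ Down.l d ≡ m ++ a ∷ b ∷ s → ¬ a Sub.∈ Z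
      int' [] refl = nz
      int' (_ ∷ m) e = Down.int d m (Listₚ.∷-injectiveʳ e)
      far : p (fromℕ< sj<k) ⋕ Down.l d
      far q with Down.below d q
      ... | i , lt , refl = not-eq , not-adj
        where
        top : toℕ (fromℕ< sj<k) ≡ suc j
        top = Finₚ.toℕ-fromℕ< sj<k
        not-eq : p (fromℕ< sj<k) ≢ p i
        not-eq e = ℕₚ.<⇒≢ (ℕₚ.m<n⇒m<1+n lt) (trans (≡-sym (cong toℕ (proj₁ path e))) top)
        not-consec : ¬ Consec (fromℕ< sj<k) i
        not-consec (inj₁ e) = ℕₚ.<⇒≱ lt (ℕₚ.≤-trans (ℕₚ.n≤1+n j) (ℕₚ.≤-trans (ℕₚ.n≤1+n (suc j)) (ℕₚ.≤-reflexive (trans (cong suc (≡-sym top)) e))))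
        not-consec (inj₂ e) = ℕₚ.<⇒≢ lt (ℕₚ.suc-injective (trans e top))
        not-adj : NonAdj G (p (fromℕ< sj<k)) (p i)
        not-adj with p (fromℕ< sj<k) #? p i
        ... | yes h = proj₂ h
        ... | no nh = ⊥-elim (not-consec (proj₁ (proj₂ path) _ _ (¬#⇒~ nh not-eq)))

    path-leg : ∀ {v} → p (fromℕ k) ≡ v → Σ (List (V G)) λ l → Leg v l × (∀ m {a b s} → l ≡ m ++ a ∷ b ∷ s → ¬ a Sub.∈ Z) × (∀ {y} → y ∈ l → Below k y)
    path-leg refl with down k (ℕₚ.n<1+n k)
    ... | d = Down.l d , subst (λ x → Leg x (Down.l d)) (cong p (Finₚ.toℕ-injective (trans (Finₚ.toℕ-fromℕ< _) (≡-sym (Finₚ.toℕ-fromℕ k))))) (Down.leg d) ,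
              Down.int d , Down.below d

-- The exponent and the theorem.

-- For `w` at least 2 the factors 12, `1 + 2 * w` and 10 are at most `w ^ 4`, `w ^ 3` and `w ^ 4`,
-- and `R` is at most `(2 + w) ^ t`, hence at most `w ^ (2 * t)`. The exponents add up to
-- `11 + 2 * t`.
final-estimate : ∀ t w → 2 ≤ w → let R = ramsey-bound (suc w) t ; K = 6 + ((R + R) + (R + R)) ; N = K + (w * K + w * K) in
                 9 + (N + (N + N)) ≤ w ^ (11 + 2 * t)
final-estimate t w 2≤w = begin
  9 + (N + (N + N))                         ≤⟨ ℕₚ.+-monoˡ-≤ _ (ℕₚ.*-monoʳ-≤ 9 1≤N) ⟩
  9 * N + (N + (N + N))                     ≡⟨ collect₁ N ⟩
  12 * N                                    ≤⟨ ℕₚ.*-mono-≤ 12≤w⁴ N≤ ⟩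
  w ^ 4 * (w ^ 3 * (w ^ 4 * w ^ (2 * t)))   ≡⟨ cong (λ z → w ^ 4 * (w ^ 3 * z)) (≡-sym (ℕₚ.^-distribˡ-+-* w 4 (2 * t))) ⟩
  w ^ 4 * (w ^ 3 * w ^ (4 + 2 * t))         ≡⟨ cong (w ^ 4 *_) (≡-sym (ℕₚ.^-distribˡ-+-* w 3 (4 + 2 * t))) ⟩
  w ^ 4 * w ^ (7 + 2 * t)                   ≡⟨ ≡-sym (ℕₚ.^-distribˡ-+-* w 4 (7 + 2 * t)) ⟩
  w ^ (11 + 2 * t) ∎
  where
  open ℕₚ.≤-Reasoning
  R K N : ℕ
  R = ramsey-bound (suc w) t
  K = 6 + ((R + R) + (R + R))
  N = K + (w * K + w * K)
  collect₁ : ∀ n → 9 * n + (n + (n + n)) ≡ 12 * n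
  collect₁ = solve-∀
  collect₂ : ∀ x → 6 * x + ((x + x) + (x + x)) ≡ 10 * x
  collect₂ = solve-∀
  collect₃ : ∀ k w → k + (w * k + w * k) ≡ (1 + 2 * w) * k
  collect₃ = solve-∀
  1≤N : 1 ≤ N
  1≤N = s≤s z≤n
  16≤w⁴ : 16 ≤ w ^ 4
  16≤w⁴ = ℕₚ.^-monoˡ-≤ 4 2≤w
  12≤w⁴ : 12 ≤ w ^ 4
  12≤w⁴ = ℕₚ.≤-trans (ℕₚ.m≤m+n 12 4) 16≤w⁴
  square : 2 + w ≤ w ^ 2
  square = begin
    2 + w         ≤⟨ ℕₚ.+-monoˡ-≤ w 2≤w ⟩
    w + w         ≡⟨ double w ⟩
    2 * w         ≤⟨ ℕₚ.*-mono-≤ 2≤w (ℕₚ.≤-reflexive (≡-sym (ℕₚ.*-identityʳ w))) ⟩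
    w ^ 2 ∎
    where
    double : ∀ w → w + w ≡ 2 * w
    double = solve-∀
  R≤ : R ≤ w ^ (2 * t)
  R≤ = begin
    R               ≤⟨ ℕₚ.≤-trans (ℕₚ.n≤1+n R) (ramsey-bound-≤ (suc w) t) ⟩
    (2 + w) ^ t     ≤⟨ ℕₚ.^-monoˡ-≤ t square ⟩
    (w ^ 2) ^ t     ≡⟨ ℕₚ.^-*-assoc w 2 t ⟩
    w ^ (2 * t) ∎
  x : ℕ
  x = w ^ (2 * t)
  1≤x : 1 ≤ x
  1≤x = ℕₚ.≤-trans (ℕₚ.≤-reflexive (≡-sym (ℕₚ.^-zeroˡ (2 * t)))) (ℕₚ.^-monoˡ-≤ (2 * t) (ℕₚ.≤-trans (s≤s z≤n) 2≤w))
  K≤ : K ≤ w ^ 4 * x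
  K≤ = begin
    6 + ((R + R) + (R + R))       ≤⟨ ℕₚ.+-mono-≤ (ℕₚ.*-monoʳ-≤ 6 1≤x) (ℕₚ.+-mono-≤ (ℕₚ.+-mono-≤ R≤ R≤) (ℕₚ.+-mono-≤ R≤ R≤)) ⟩
    6 * x + ((x + x) + (x + x))   ≡⟨ collect₂ x ⟩
    10 * x                        ≤⟨ ℕₚ.*-monoˡ-≤ x (ℕₚ.≤-trans (ℕₚ.m≤m+n 10 6) 16≤w⁴) ⟩
    w ^ 4 * x ∎
  cube : 1 + 2 * w ≤ w ^ 3
  cube = begin
    1 + 2 * w             ≤⟨ ℕₚ.+-monoˡ-≤ (2 * w) (ℕₚ.≤-trans (s≤s z≤n) 2≤w) ⟩
    w + 2 * w             ≤⟨ ℕₚ.m≤m+n _ w ⟩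
    w + 2 * w + w         ≡⟨ four w ⟩
    4 * w                 ≡⟨ ℕₚ.*-comm 4 w ⟩
    w * 4                 ≤⟨ ℕₚ.*-monoʳ-≤ w (ℕₚ.^-monoˡ-≤ 2 2≤w) ⟩
    w ^ 3 ∎
    where
    four : ∀ w → w + 2 * w + w ≡ 4 * w
    four = solve-∀
  N≤ : N ≤ w ^ 3 * (w ^ 4 * x)
  N≤ = begin
    N                    ≡⟨ collect₃ K w ⟩
    (1 + 2 * w) * K      ≤⟨ ℕₚ.*-mono-≤ cube K≤ ⟩
    w ^ 3 * (w ^ 4 * x) ∎

theorem4p2 : (t : ℕ) → Σ ℕ λ c →
    (G : Graph) → KttFree G t →
    (w : ℕ) → IsCliqueNumber G w →
    (Z : VSet G) → Constricted G Z →
    (v : V G) → v ∉ Z →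
    (m : ℕ) (len : Fin m → ℕ) (P : (i : Fin m) → Fin (suc (len i)) → V G) →
    PathFamily G Z v m len P → m ≤ w ^ c
theorem4p2 t = 11 + 2 * t , proof
  where
  proof : (G : Graph) → KttFree G t → (w : ℕ) → IsCliqueNumber G w → (Z : VSet G) → Constricted G Z → (v : V G) → v ∉ Z →
    (m : ℕ) (len : Fin m → ℕ) (P : (i : Fin m) → Fin (suc (len i)) → V G) → PathFamily G Z v m len P → m ≤ w ^ (11 + 2 * t)
  proof G free w isω Z con v v∉Z zero len P fam = z≤n
  proof G free w isω Z con v v∉Z m@(suc _) len P (induced , starts , ends , disjoint) =
    ℕₚ.≤-trans (subst (_≤ N₃) (Listₚ.length-tabulate member) (path-bound v∉Z (tabulate member) (AllPairsₚ.tabulate⁺ {f = member} (λ {i} {j} → disj {i} {j}))))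
      (final-estimate t w 2≤w)
    where
    stableZ : ∀ {x y} → x Sub.∈ Z → y Sub.∈ Z → ¬ Basics._~_ G x y
    stableZ {x} {y} p q a with trans (≡-sym (proj₁ con x y p q)) a
    ... | ()
    open Bound G (Sub._∈ Z) (Basics.spiderless G Z con) w t (clique-list G isω) (Ktt-list G free) stableZ
    path : ∀ i → _
    path i = path-leg G Z (induced i) (starts i) (ends i)
    member : Fin m → Mem v
    member i = mem (proj₁ (path i)) (proj₁ (proj₂ (path i))) (proj₁ (proj₂ (proj₂ (path i))))
    disj : ∀ {i j} → i ≢ j → Disj (member i) (member j)
    disj {i} {j} n p q with proj₂ (proj₂ (proj₂ (path i))) p | proj₂ (proj₂ (proj₂ (path j))) q
    ... | a , a<k , e | b , _ , e' = ℕₚ.<⇒≢ a<k (trans (cong toℕ (proj₁ (induced i) (trans at-v (≡-sym (ends i))))) (Finₚ.toℕ-fromℕ _))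
      where
      at-v : P i a ≡ v
      at-v = disjoint i j n a b (trans e (≡-sym e'))
    -- `v` is not in `Z`, so a path to it has an edge at `v`. The empty family was treated apart
    -- because it gives no such edge.
    2≤w : 2 ≤ w
    2≤w with proj₁ (path Fin.zero) | proj₁ (proj₂ (path Fin.zero))
    ... | _ | end z = ⊥-elim (v∉Z z)
    ... | _ | step {y = y} a _ _ = clique-list G isω (v ∷ y ∷ []) ((a ∷ []) ∷ [] ∷ [])
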